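{- Let $\mu_m=\dfrac{(aq;q)_m}{(abq^2;q)_m}$ for integers $m\ge 0$. Let $n$ be a positive integer. Then $$\det\left(\mu_{i+j}\right)_{0\le i,j\le n-1}=a^{\frac12 n(n-1)}\,q^{\frac16 n(n-1)(2n-1)}\prod_{k=1}^{n}\frac{(q;q)_{n-k}\,(aq;q)_{n-k}\,(bq;q)_{n-k}}{(abq^{n-k+1};q)_{n-k}\,(abq^{2};q)_{2(n-k)}}.$$
   Context: Here $a,b,q$ are indeterminates, and the identity is an identity of rational functions in $a,b,q$. For a nonnegative integer $m$, the $q$-shifted factorial is $(x;q)_m=\prod_{k=0}^{m-1}(1-xq^k)$, with $(x;q)_0=1$. -}

module Defs where

open import Algebra.Bundles using (CommutativeRing; Semiring)
import Algebra.Definitions.RawSemiring as RawSemiringDefs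
import Algebra.Properties.CommutativeSemigroup as CommutativeSemigroupProperties
import Algebra.Properties.Ring as RingProperties
import Algebra.Solver.Ring.NaturalCoefficients.Default as NaturalCoefficients
open import Data.Empty using (⊥-elim)
open import Data.Fin.Base using (Fin; zero; suc; toℕ; punchIn)
open import Data.List.Base using (List; []; _∷_; map)
open import Data.Nat.Base using (ℕ; zero; suc)
open import Data.Product.Base using (∃; _,_; proj₂)
open import Data.Sum.Base using (_⊎_; inj₁; inj₂; [_,_]′)
open import Data.Vec.Functional using (Vector)
open import Level using (_⊔_) renaming (suc to lsuc)
open import Relation.Binary.Definitions using (Decidable)
import Relation.Binary.Reasoning.Setoid as SetoidReasoning
open import Relation.Nullary.Decidable using (Dec; yes; no)
open import Relation.Nullary.Negation using (¬_)

record DiscreteDomain c ℓ : Set (lsuc (c ⊔ ℓ)) where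
  infix 4 _≟_
  field
    commutativeRing : CommutativeRing c ℓ
  open CommutativeRing commutativeRing public hiding (zero)
  field
    _≟_             : Decidable _≈_
    1≉0             : ¬ 1# ≈ 0#
    noZeroDivisors  : ∀ {x y} → x * y ≈ 0# → x ≈ 0# ⊎ y ≈ 0#

-- Inversion is total, with 0 ⁻¹ ≈ 0; only the inverses of nonzero
-- elements carry meaning.
record DiscreteField c ℓ : Set (lsuc (c ⊔ ℓ)) where
  infix  4 _≟_
  infix  9 _⁻¹
  infixl 7 _/_
  field
    commutativeRing : CommutativeRing c ℓ
  open CommutativeRing commutativeRing public hiding (zero)
  field
    _≟_         : Decidable _≈_
    1≉0         : ¬ 1# ≈ 0#
    _⁻¹         : Carrier → Carrier
    *-inverseʳ  : ∀ x → ¬ x ≈ 0# → x * x ⁻¹ ≈ 1#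
    0⁻¹≈0       : ∀ x → x ≈ 0# → x ⁻¹ ≈ 0#

  _/_ : Carrier → Carrier → Carrier
  x / y = x * y ⁻¹

module RingNotation {c ℓ} (R : CommutativeRing c ℓ) where
  open CommutativeRing R hiding (zero)
  open RawSemiringDefs (Semiring.rawSemiring semiring) public using (_^_; sum; product)

  infix 8 ⟨_⨾_⟩_

  -- ⟨ x ⨾ q ⟩ m is (x;q)ₘ.
  ⟨_⨾_⟩_ : Carrier → Carrier → ℕ → Carrier
  ⟨ x ⨾ q ⟩ m = product {m} (λ k → 1# - x * q ^ toℕ k)

  -- ∏[ k ≤ n ] e is the product of e over 1 ≤ k ≤ n.
  ∏₁ : ℕ → (ℕ → Carrier) → Carrier
  ∏₁ n f = product {n} (λ i → f (suc (toℕ i)))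

  infix 6 ∏₁
  syntax ∏₁ n (λ k → e) = ∏[ k ≤ n ] e

  Matrix : ℕ → Set c
  Matrix n = Fin n → Fin n → Carrier

  minor : ∀ {n} → Matrix (suc n) → Fin (suc n) → Matrix n
  minor A j i k = A (suc i) (punchIn j k)

  -- Laplace expansion along the first row.
  det : ∀ {n} → Matrix n → Carrier
  det {zero}  A = 1#
  det {suc n} A = sum (λ j → (- 1#) ^ toℕ j * A zero j * det (minor A j))

-- Polynomials in one variable are lists of coefficients, constant term
-- first, considered up to trailing zeros.
module Polynomial {c ℓ} (D : DiscreteDomain c ℓ) where
  open DiscreteDomain D
  open RingProperties ring using (-0#≈0#)
  open CommutativeSemigroupProperties +-commutativeSemigroup
    using () renaming (interchange to +-interchange)
  open SetoidReasoning setoid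

  Poly : Set c
  Poly = List Carrier

  coeff : Poly → ℕ → Carrier
  coeff []      n       = 0#
  coeff (x ∷ p) zero    = x
  coeff (x ∷ p) (suc n) = coeff p n

  infix  4 _≈ₚ_
  infixl 6 _+ₚ_
  infixl 7 _*ₚ_ _·_

  record _≈ₚ_ (p r : Poly) : Set ℓ where
    constructor coeffwise
    field at : ∀ n → coeff p n ≈ coeff r n
  open _≈ₚ_ public

  _+ₚ_ : Poly → Poly → Poly
  []      +ₚ r       = r
  (x ∷ p) +ₚ []      = x ∷ p
  (x ∷ p) +ₚ (y ∷ r) = (x + y) ∷ (p +ₚ r)

  -ₚ_ : Poly → Poly
  -ₚ_ = map (λ x → - x)

  _·_ : Carrier → Poly → Poly
  x · p = map (x *_) p

  _*ₚ_ : Poly → Poly → Poly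
  []      *ₚ r = []
  (x ∷ p) *ₚ r = x · r +ₚ (0# ∷ p *ₚ r)

  0ₚ 1ₚ X : Poly
  0ₚ = []
  1ₚ = 1# ∷ []
  X  = 0# ∷ 1# ∷ []

  const : Carrier → Poly
  const x = x ∷ []

  coeff-+ : ∀ p r n → coeff (p +ₚ r) n ≈ coeff p n + coeff r n
  coeff-+ []      r       n       = sym (+-identityˡ _)
  coeff-+ (x ∷ p) []      n       = sym (+-identityʳ _)
  coeff-+ (x ∷ p) (y ∷ r) zero    = refl
  coeff-+ (x ∷ p) (y ∷ r) (suc n) = coeff-+ p r n

  coeff-neg : ∀ p n → coeff (-ₚ p) n ≈ - coeff p n
  coeff-neg []      n       = sym -0#≈0#
  coeff-neg (x ∷ p) zero    = refl
  coeff-neg (x ∷ p) (suc n) = coeff-neg p n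

  coeff-· : ∀ x p n → coeff (x · p) n ≈ x * coeff p n
  coeff-· x []      n       = sym (zeroʳ x)
  coeff-· x (y ∷ p) zero    = refl
  coeff-· x (y ∷ p) (suc n) = coeff-· x p n

  reflₚ : ∀ {p} → p ≈ₚ p
  reflₚ .at n = refl

  symₚ : ∀ {p r} → p ≈ₚ r → r ≈ₚ p
  symₚ e .at n = sym (at e n)

  transₚ : ∀ {p r s} → p ≈ₚ r → r ≈ₚ s → p ≈ₚ s
  transₚ e f .at n = trans (at e n) (at f n)

  ∷-cong : ∀ {x y p r} → x ≈ y → p ≈ₚ r → x ∷ p ≈ₚ y ∷ r
  ∷-cong x≈y p≈r .at zero    = x≈y
  ∷-cong x≈y p≈r .at (suc n) = at p≈r n

  head-≈ : ∀ {x y p r} → x ∷ p ≈ₚ y ∷ r → x ≈ y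
  head-≈ e = at e 0

  tail-≈ : ∀ {x y p r} → x ∷ p ≈ₚ y ∷ r → p ≈ₚ r
  tail-≈ e .at n = at e (suc n)

  0∷-≈ : ∀ {x p} → x ≈ 0# → p ≈ₚ [] → x ∷ p ≈ₚ []
  0∷-≈ e f .at zero    = e
  0∷-≈ e f .at (suc n) = at f n

  +ₚ-cong : ∀ {p p′ r r′} → p ≈ₚ p′ → r ≈ₚ r′ → p +ₚ r ≈ₚ p′ +ₚ r′
  +ₚ-cong {p} {p′} {r} {r′} e f .at n = begin
    coeff (p +ₚ r) n        ≈⟨ coeff-+ p r n ⟩
    coeff p n + coeff r n   ≈⟨ +-cong (at e n) (at f n) ⟩
    coeff p′ n + coeff r′ n ≈⟨ coeff-+ p′ r′ n ⟨
    coeff (p′ +ₚ r′) n      ∎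

  +ₚ-assoc : ∀ p r s → (p +ₚ r) +ₚ s ≈ₚ p +ₚ (r +ₚ s)
  +ₚ-assoc p r s .at n = begin
    coeff ((p +ₚ r) +ₚ s) n               ≈⟨ coeff-+ (p +ₚ r) s n ⟩
    coeff (p +ₚ r) n + coeff s n          ≈⟨ +-congʳ (coeff-+ p r n) ⟩
    coeff p n + coeff r n + coeff s n     ≈⟨ +-assoc _ _ _ ⟩
    coeff p n + (coeff r n + coeff s n)   ≈⟨ +-congˡ (coeff-+ r s n) ⟨
    coeff p n + coeff (r +ₚ s) n          ≈⟨ coeff-+ p (r +ₚ s) n ⟨
    coeff (p +ₚ (r +ₚ s)) n               ∎

  +ₚ-comm : ∀ p r → p +ₚ r ≈ₚ r +ₚ p
  +ₚ-comm p r .at n = begin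
    coeff (p +ₚ r) n       ≈⟨ coeff-+ p r n ⟩
    coeff p n + coeff r n  ≈⟨ +-comm _ _ ⟩
    coeff r n + coeff p n  ≈⟨ coeff-+ r p n ⟨
    coeff (r +ₚ p) n       ∎

  +ₚ-identityʳ : ∀ p → p +ₚ 0ₚ ≈ₚ p
  +ₚ-identityʳ p = +ₚ-comm p 0ₚ

  -ₚ-cong : ∀ {p r} → p ≈ₚ r → -ₚ p ≈ₚ -ₚ r
  -ₚ-cong {p} {r} e .at n = begin
    coeff (-ₚ p) n  ≈⟨ coeff-neg p n ⟩
    - coeff p n     ≈⟨ -‿cong (at e n) ⟩
    - coeff r n     ≈⟨ coeff-neg r n ⟨
    coeff (-ₚ r) n  ∎

  -ₚ-inverseʳ : ∀ p → p +ₚ (-ₚ p) ≈ₚ 0ₚ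
  -ₚ-inverseʳ p .at n = begin
    coeff (p +ₚ (-ₚ p)) n       ≈⟨ coeff-+ p (-ₚ p) n ⟩
    coeff p n + coeff (-ₚ p) n  ≈⟨ +-congˡ (coeff-neg p n) ⟩
    coeff p n + - coeff p n     ≈⟨ -‿inverseʳ _ ⟩
    0#                          ∎

  +ₚ-interchange : ∀ p r s t →
                   (p +ₚ r) +ₚ (s +ₚ t) ≈ₚ (p +ₚ s) +ₚ (r +ₚ t)
  +ₚ-interchange p r s t .at n = begin
    coeff ((p +ₚ r) +ₚ (s +ₚ t)) n
      ≈⟨ coeff-+ (p +ₚ r) (s +ₚ t) n ⟩
    coeff (p +ₚ r) n + coeff (s +ₚ t) n
      ≈⟨ +-cong (coeff-+ p r n) (coeff-+ s t n) ⟩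
    (coeff p n + coeff r n) + (coeff s n + coeff t n)
      ≈⟨ +-interchange _ _ _ _ ⟩
    (coeff p n + coeff s n) + (coeff r n + coeff t n)
      ≈⟨ +-cong (coeff-+ p s n) (coeff-+ r t n) ⟨
    coeff (p +ₚ s) n + coeff (r +ₚ t) n
      ≈⟨ coeff-+ (p +ₚ s) (r +ₚ t) n ⟨
    coeff ((p +ₚ s) +ₚ (r +ₚ t)) n
      ∎

  ·-cong : ∀ {x y p r} → x ≈ y → p ≈ₚ r → x · p ≈ₚ y · r
  ·-cong {x} {y} {p} {r} x≈y p≈r .at n = begin
    coeff (x · p) n  ≈⟨ coeff-· x p n ⟩
    x * coeff p n    ≈⟨ *-cong x≈y (at p≈r n) ⟩
    y * coeff r n    ≈⟨ coeff-· y r n ⟨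
    coeff (y · r) n  ∎

  ·-distribˡ : ∀ x p r → x · (p +ₚ r) ≈ₚ x · p +ₚ x · r
  ·-distribˡ x p r .at n = begin
    coeff (x · (p +ₚ r)) n             ≈⟨ coeff-· x (p +ₚ r) n ⟩
    x * coeff (p +ₚ r) n               ≈⟨ *-congˡ (coeff-+ p r n) ⟩
    x * (coeff p n + coeff r n)        ≈⟨ distribˡ _ _ _ ⟩
    x * coeff p n + x * coeff r n      ≈⟨ +-cong (coeff-· x p n) (coeff-· x r n) ⟨
    coeff (x · p) n + coeff (x · r) n  ≈⟨ coeff-+ (x · p) (x · r) n ⟨
    coeff (x · p +ₚ x · r) n           ∎

  ·-assoc : ∀ x y p → (x * y) · p ≈ₚ x · (y · p)
  ·-assoc x y p .at n = begin
    coeff ((x * y) · p) n  ≈⟨ coeff-· (x * y) p n ⟩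
    x * y * coeff p n      ≈⟨ *-assoc _ _ _ ⟩
    x * (y * coeff p n)    ≈⟨ *-congˡ (coeff-· y p n) ⟨
    x * coeff (y · p) n    ≈⟨ coeff-· x (y · p) n ⟨
    coeff (x · (y · p)) n  ∎

  ·-identity : ∀ p → 1# · p ≈ₚ p
  ·-identity p .at n = trans (coeff-· 1# p n) (*-identityˡ _)

  0·≈0 : ∀ {x} p → x ≈ 0# → x · p ≈ₚ []
  0·≈0 p x≈0 .at n = trans (coeff-· _ p n) (trans (*-congʳ x≈0) (zeroˡ _))

  *ₚ-congˡ : ∀ p {r s} → r ≈ₚ s → p *ₚ r ≈ₚ p *ₚ s
  *ₚ-congˡ []      e = reflₚ
  *ₚ-congˡ (x ∷ p) e = +ₚ-cong (·-cong refl e) (∷-cong refl (*ₚ-congˡ p e))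

  *ₚ-zeroʳ : ∀ p → p *ₚ [] ≈ₚ []
  *ₚ-zeroʳ []      = reflₚ
  *ₚ-zeroʳ (x ∷ p) = 0∷-≈ refl (*ₚ-zeroʳ p)

  *ₚ-distribˡ : ∀ p r s → p *ₚ (r +ₚ s) ≈ₚ p *ₚ r +ₚ p *ₚ s
  *ₚ-distribˡ []      r s = reflₚ
  *ₚ-distribˡ (x ∷ p) r s = transₚ
    (+ₚ-cong (·-distribˡ x r s)
             (∷-cong (sym (+-identityˡ 0#)) (*ₚ-distribˡ p r s)))
    (+ₚ-interchange (x · r) (x · s) (0# ∷ p *ₚ r) (0# ∷ p *ₚ s))

  *ₚ-∷ʳ : ∀ p y r → p *ₚ (y ∷ r) ≈ₚ y · p +ₚ (0# ∷ p *ₚ r)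
  *ₚ-∷ʳ []      y r = symₚ (0∷-≈ refl reflₚ)
  *ₚ-∷ʳ (x ∷ p) y r = ∷-cong (+-congʳ (*-comm x y)) (transₚ
    (+ₚ-cong reflₚ (*ₚ-∷ʳ p y r))
    (transₚ (symₚ (+ₚ-assoc (x · r) (y · p) (0# ∷ p *ₚ r)))
    (transₚ (+ₚ-cong (+ₚ-comm (x · r) (y · p)) reflₚ)
            (+ₚ-assoc (y · p) (x · r) (0# ∷ p *ₚ r)))))

  *ₚ-comm : ∀ p r → p *ₚ r ≈ₚ r *ₚ p
  *ₚ-comm []      r = symₚ (*ₚ-zeroʳ r)
  *ₚ-comm (x ∷ p) r = transₚ
    (+ₚ-cong reflₚ (∷-cong refl (*ₚ-comm p r)))
    (symₚ (*ₚ-∷ʳ r x p))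

  *ₚ-cong : ∀ {p p′ r r′} → p ≈ₚ p′ → r ≈ₚ r′ → p *ₚ r ≈ₚ p′ *ₚ r′
  *ₚ-cong {p} {p′} {r} {r′} e f =
    transₚ (*ₚ-congˡ p f)
    (transₚ (*ₚ-comm p r′) (transₚ (*ₚ-congˡ r′ e) (*ₚ-comm r′ p′)))

  *ₚ-distribʳ : ∀ s p r → (p +ₚ r) *ₚ s ≈ₚ p *ₚ s +ₚ r *ₚ s
  *ₚ-distribʳ s p r =
    transₚ (*ₚ-comm (p +ₚ r) s)
    (transₚ (*ₚ-distribˡ s p r) (+ₚ-cong (*ₚ-comm s p) (*ₚ-comm s r)))

  ·-*ₚ : ∀ x p r → (x · p) *ₚ r ≈ₚ x · (p *ₚ r)
  ·-*ₚ x []      r = reflₚ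
  ·-*ₚ x (y ∷ p) r = transₚ
    (+ₚ-cong (·-assoc x y r) (∷-cong (sym (zeroʳ x)) (·-*ₚ x p r)))
    (symₚ (·-distribˡ x (y · r) (0# ∷ p *ₚ r)))

  0∷-*ₚ : ∀ {x} p r → x ≈ 0# → (x ∷ p) *ₚ r ≈ₚ 0# ∷ p *ₚ r
  0∷-*ₚ p r x≈0 = +ₚ-cong (0·≈0 r x≈0) reflₚ

  *ₚ-assoc : ∀ p r s → (p *ₚ r) *ₚ s ≈ₚ p *ₚ (r *ₚ s)
  *ₚ-assoc []      r s = reflₚ
  *ₚ-assoc (x ∷ p) r s = transₚ
    (*ₚ-distribʳ s (x · r) (0# ∷ p *ₚ r))
    (+ₚ-cong (·-*ₚ x r s)
      (transₚ (0∷-*ₚ (p *ₚ r) s refl) (∷-cong refl (*ₚ-assoc p r s))))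

  *ₚ-identityˡ : ∀ p → 1ₚ *ₚ p ≈ₚ p
  *ₚ-identityˡ p = transₚ
    (+ₚ-cong (·-identity p) (0∷-≈ refl reflₚ)) (+ₚ-identityʳ p)

  polyRing : CommutativeRing c ℓ
  polyRing = record
    { Carrier = Poly
    ; _≈_ = _≈ₚ_
    ; _+_ = _+ₚ_
    ; _*_ = _*ₚ_
    ; -_ = -ₚ_
    ; 0# = 0ₚ
    ; 1# = 1ₚ
    ; isCommutativeRing = record
      { isRing = record
        { +-isAbelianGroup = record
          { isGroup = record
            { isMonoid = record
              { isSemigroup = record
                { isMagma = record
                  { isEquivalence = record
                    { refl = reflₚ ; sym = symₚ ; trans = transₚ }
                  ; ∙-cong = +ₚ-cong
                  }
                ; assoc = +ₚ-assoc
                }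
              ; identity = (λ p → reflₚ) , +ₚ-identityʳ
              }
            ; inverse =
                (λ p → transₚ (+ₚ-comm (-ₚ p) p) (-ₚ-inverseʳ p)) , -ₚ-inverseʳ
            ; ⁻¹-cong = -ₚ-cong
            }
          ; comm = +ₚ-comm
          }
        ; *-cong = *ₚ-cong
        ; *-assoc = *ₚ-assoc
        ; *-identity =
            *ₚ-identityˡ , λ p → transₚ (*ₚ-comm p 1ₚ) (*ₚ-identityˡ p)
        ; distrib = *ₚ-distribˡ , *ₚ-distribʳ
        }
      ; *-comm = *ₚ-comm
      }
    }

  []≟ : ∀ p → Dec (p ≈ₚ [])
  []≟ []      = yes reflₚ
  []≟ (x ∷ p) with x ≟ 0# | []≟ p
  ... | yes e | yes f = yes (0∷-≈ e f)
  ... | no ¬e | _     = no λ g → ¬e (at g 0)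
  ... | yes _ | no ¬f = no λ g → ¬f (coeffwise λ n → at g (suc n))

  _≟ₚ_ : Decidable _≈ₚ_
  []      ≟ₚ r       with []≟ r
  ... | yes e = yes (symₚ e)
  ... | no ¬e = no λ g → ¬e (symₚ g)
  (x ∷ p) ≟ₚ []      = []≟ (x ∷ p)
  (x ∷ p) ≟ₚ (y ∷ r) with x ≟ y | p ≟ₚ r
  ... | yes e | yes f = yes (∷-cong e f)
  ... | no ¬e | _     = no λ g → ¬e (head-≈ g)
  ... | yes _ | no ¬f = no λ g → ¬f (tail-≈ g)

  private
    noZeroDivisors-∷ : ∀ x p y r → Dec (x ≈ 0#) → Dec (y ≈ 0#) →
      (p *ₚ (y ∷ r) ≈ₚ [] → p ≈ₚ [] ⊎ y ∷ r ≈ₚ []) →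
      ((x ∷ p) *ₚ r ≈ₚ [] → x ∷ p ≈ₚ [] ⊎ r ≈ₚ []) →
      (x ∷ p) *ₚ (y ∷ r) ≈ₚ [] → x ∷ p ≈ₚ [] ⊎ y ∷ r ≈ₚ []
    noZeroDivisors-∷ x p y r (yes x≈0) _ ihˡ ihʳ e =
      [ (λ f → inj₁ (0∷-≈ x≈0 f)) , inj₂ ]′ (ihˡ (coeffwise λ n →
        trans (sym (at (0∷-*ₚ p (y ∷ r) x≈0) (suc n))) (at e (suc n))))
    noZeroDivisors-∷ x p y r (no x≉0) (yes y≈0) ihˡ ihʳ e =
      [ inj₁ , (λ f → inj₂ (0∷-≈ y≈0 f)) ]′ (ihʳ (coeffwise λ n →
        trans (sym (at shifted (suc n))) (at e (suc n))))
      where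
      shifted : (x ∷ p) *ₚ (y ∷ r) ≈ₚ 0# ∷ (x ∷ p) *ₚ r
      shifted = transₚ (*ₚ-∷ʳ (x ∷ p) y r) (+ₚ-cong (0·≈0 (x ∷ p) y≈0) reflₚ)
    noZeroDivisors-∷ x p y r (no x≉0) (no y≉0) ihˡ ihʳ e =
      ⊥-elim ([ x≉0 , y≉0 ]′
        (noZeroDivisors (trans (sym (+-identityʳ _)) (at e 0))))

  *ₚ-noZeroDivisors : ∀ p r → p *ₚ r ≈ₚ [] → p ≈ₚ [] ⊎ r ≈ₚ []
  *ₚ-noZeroDivisors []      r       = λ _ → inj₁ reflₚ
  *ₚ-noZeroDivisors (x ∷ p) []      = λ _ → inj₂ reflₚ
  *ₚ-noZeroDivisors (x ∷ p) (y ∷ r) = noZeroDivisors-∷ x p y r (x ≟ 0#) (y ≟ 0#)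
    (*ₚ-noZeroDivisors p (y ∷ r)) (*ₚ-noZeroDivisors (x ∷ p) r)

  polyDomain : DiscreteDomain c ℓ
  polyDomain = record
    { commutativeRing = polyRing
    ; _≟_             = _≟ₚ_
    ; 1≉0             = λ e → 1≉0 (at e 0)
    ; noZeroDivisors  = λ {p} {r} → *ₚ-noZeroDivisors p r
    }

private
  module FractionIdentities {c ℓ} (R : CommutativeRing c ℓ) where
    open CommutativeRing R
    open NaturalCoefficients commutativeSemiring

    trans-id₁ : ∀ e m f → e * (m * f) ≈ m * e * f
    trans-id₁ = solve 3 (λ e m f → e :* (m :* f) := m :* e :* f) refl

    trans-id₂ : ∀ n d f → n * d * f ≈ n * f * d
    trans-id₂ = solve 3 (λ n d f → n :* d :* f := n :* f :* d) refl

    trans-id₃ : ∀ o e d → o * e * d ≈ e * (o * d)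
    trans-id₃ = solve 3 (λ o e d → o :* e :* d := e :* (o :* d)) refl

    +-cong-id₁ : ∀ m d n e d′ e′ → (m * e + n * d) * (d′ * e′)
      ≈ m * d′ * (e * e′) + n * e′ * (d * d′)
    +-cong-id₁ = solve 6 (λ m d n e d′ e′ → (m :* e :+ n :* d) :* (d′ :* e′)
      := m :* d′ :* (e :* e′) :+ n :* e′ :* (d :* d′)) refl

    +-cong-id₂ : ∀ m′ d n′ e d′ e′ → m′ * d * (e * e′) + n′ * e * (d * d′)
      ≈ (m′ * e′ + n′ * d′) * (d * e)
    +-cong-id₂ = solve 6 (λ m′ d n′ e d′ e′ → m′ :* d :* (e :* e′) :+ n′ :* e :* (d :* d′)
      := (m′ :* e′ :+ n′ :* d′) :* (d :* e)) refl

    *-cong-id : ∀ u v w z → u * v * (w * z) ≈ u * w * (v * z)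
    *-cong-id = solve 4 (λ u v w z → u :* v :* (w :* z) := u :* w :* (v :* z)) refl

    +-assoc-id : ∀ m d n e o f →
      ((m * e + n * d) * f + o * (d * e)) * (d * (e * f))
      ≈ (m * (e * f) + (n * f + o * e) * d) * (d * e * f)
    +-assoc-id = solve 6 (λ m d n e o f →
      ((m :* e :+ n :* d) :* f :+ o :* (d :* e)) :* (d :* (e :* f))
      := (m :* (e :* f) :+ (n :* f :+ o :* e) :* d) :* (d :* e :* f)) refl

    +-comm-id : ∀ m d n e →
      (m * e + n * d) * (e * d) ≈ (n * d + m * e) * (d * e)
    +-comm-id = solve 4 (λ m d n e →
      (m :* e :+ n :* d) :* (e :* d) := (n :* d :+ m :* e) :* (d :* e)) refl

    +-identity-id : ∀ m d → (0# * d + m * 1#) * d ≈ m * (1# * d)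
    +-identity-id = solve 2 (λ m d → (con 0 :* d :+ m :* con 1) :* d := m :* (con 1 :* d)) refl

    distrib-id : ∀ m d n e o f → m * (n * f + o * e) * (d * e * (d * f))
      ≈ (m * n * (d * f) + m * o * (d * e)) * (d * (e * f))
    distrib-id = solve 6 (λ m d n e o f → m :* (n :* f :+ o :* e) :* (d :* e :* (d :* f))
      := (m :* n :* (d :* f) :+ m :* o :* (d :* e)) :* (d :* (e :* f))) refl

    inverse-id : ∀ m d → m * d * 1# ≈ 1# * (d * m)
    inverse-id = solve 2 (λ m d → m :* d :* con 1 := con 1 :* (d :* m)) refl

module FractionField {c ℓ} (D : DiscreteDomain c ℓ) where
  open DiscreteDomain D
  open RingProperties ring using (x∙y⁻¹≈ε⇒x≈y; -‿distribˡ-*; -‿distribʳ-*)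
  open SetoidReasoning setoid

  open FractionIdentities commutativeRing

  record Fraction : Set (c ⊔ ℓ) where
    constructor fraction
    field
      num    : Carrier
      den    : Carrier
      den≉0  : ¬ den ≈ 0#
  open Fraction public

  infix  4 _≈ᶠ_
  infixl 6 _+ᶠ_
  infixl 7 _*ᶠ_

  record _≈ᶠ_ (x y : Fraction) : Set ℓ where
    constructor cross
    field uncross : num x * den y ≈ num y * den x
  open _≈ᶠ_ public

  *-≉0 : ∀ {x y} → ¬ x ≈ 0# → ¬ y ≈ 0# → ¬ x * y ≈ 0#
  *-≉0 x≉0 y≉0 e = [ x≉0 , y≉0 ]′ (noZeroDivisors e)

  *-cancelˡ : ∀ z {x y} → ¬ z ≈ 0# → z * x ≈ z * y → x ≈ y
  *-cancelˡ z {x} {y} z≉0 e =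
    [ (λ f → ⊥-elim (z≉0 f)) , x∙y⁻¹≈ε⇒x≈y x y ]′ (noZeroDivisors (begin
      z * (x - y)        ≈⟨ distribˡ z x (- y) ⟩
      z * x + z * (- y)  ≈⟨ +-cong e (sym (-‿distribʳ-* z y)) ⟩
      z * y - z * y      ≈⟨ -‿inverseʳ _ ⟩
      0#                 ∎))

  ι : Carrier → Fraction
  ι x = fraction x 1# 1≉0

  0ᶠ 1ᶠ : Fraction
  0ᶠ = ι 0#
  1ᶠ = ι 1#

  _+ᶠ_ _*ᶠ_ : Fraction → Fraction → Fraction
  fraction m d d≉0 +ᶠ fraction n e e≉0 =
    fraction (m * e + n * d) (d * e) (*-≉0 d≉0 e≉0)
  fraction m d d≉0 *ᶠ fraction n e e≉0 =
    fraction (m * n) (d * e) (*-≉0 d≉0 e≉0)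

  -ᶠ_ : Fraction → Fraction
  -ᶠ fraction m d d≉0 = fraction (- m) d d≉0

  _⁻¹ᶠ : Fraction → Fraction
  fraction m d d≉0 ⁻¹ᶠ with m ≟ 0#
  ... | yes _   = 0ᶠ
  ... | no  m≉0 = fraction d m m≉0

  transᶠ : ∀ {x y z} → x ≈ᶠ y → y ≈ᶠ z → x ≈ᶠ z
  transᶠ {fraction m d _} {fraction n e e≉0} {fraction o f _} (cross p) (cross r) =
    cross (*-cancelˡ e e≉0 (begin
      e * (m * f)  ≈⟨ trans-id₁ e m f ⟩
      m * e * f    ≈⟨ *-congʳ p ⟩
      n * d * f    ≈⟨ trans-id₂ n d f ⟩
      n * f * d    ≈⟨ *-congʳ r ⟩
      o * e * d    ≈⟨ trans-id₃ o e d ⟩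
      e * (o * d)  ∎))

  +ᶠ-cong : ∀ {x x′ y y′} → x ≈ᶠ x′ → y ≈ᶠ y′ → x +ᶠ y ≈ᶠ x′ +ᶠ y′
  +ᶠ-cong {fraction m d _} {fraction m′ d′ _} {fraction n e _} {fraction n′ e′ _}
          (cross p) (cross r) = cross (begin
    (m * e + n * d) * (d′ * e′)
      ≈⟨ +-cong-id₁ m d n e d′ e′ ⟩
    m * d′ * (e * e′) + n * e′ * (d * d′)
      ≈⟨ +-cong (*-congʳ p) (*-congʳ r) ⟩
    m′ * d * (e * e′) + n′ * e * (d * d′)
      ≈⟨ +-cong-id₂ m′ d n′ e d′ e′ ⟩
    (m′ * e′ + n′ * d′) * (d * e) ∎)

  *ᶠ-cong : ∀ {x x′ y y′} → x ≈ᶠ x′ → y ≈ᶠ y′ → x *ᶠ y ≈ᶠ x′ *ᶠ y′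
  *ᶠ-cong {fraction m d _} {fraction m′ d′ _} {fraction n e _} {fraction n′ e′ _}
          (cross p) (cross r) = cross (begin
    m * n * (d′ * e′)      ≈⟨ *-cong-id m n d′ e′ ⟩
    m * d′ * (n * e′)      ≈⟨ *-cong p r ⟩
    m′ * d * (n′ * e)      ≈⟨ *-cong-id m′ d n′ e ⟩
    m′ * n′ * (d * e)      ∎)

  -ᶠ-cong : ∀ {x y} → x ≈ᶠ y → -ᶠ x ≈ᶠ -ᶠ y
  -ᶠ-cong {fraction m d _} {fraction n e _} (cross p) = cross (begin
    - m * e    ≈⟨ -‿distribˡ-* m e ⟨
    - (m * e)  ≈⟨ -‿cong p ⟩
    - (n * d)  ≈⟨ -‿distribˡ-* n d ⟩
    - n * d    ∎)

  +ᶠ-assoc : ∀ x y z → (x +ᶠ y) +ᶠ z ≈ᶠ x +ᶠ (y +ᶠ z)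
  +ᶠ-assoc (fraction m d _) (fraction n e _) (fraction o f _) =
    cross (+-assoc-id m d n e o f)

  +ᶠ-comm : ∀ x y → x +ᶠ y ≈ᶠ y +ᶠ x
  +ᶠ-comm (fraction m d _) (fraction n e _) = cross (+-comm-id m d n e)

  +ᶠ-identityˡ : ∀ x → 0ᶠ +ᶠ x ≈ᶠ x
  +ᶠ-identityˡ (fraction m d _) = cross (+-identity-id m d)

  -ᶠ-inverseˡ : ∀ x → (-ᶠ x) +ᶠ x ≈ᶠ 0ᶠ
  -ᶠ-inverseˡ (fraction m d _) = cross (begin
    (- m * d + m * d) * 1#  ≈⟨ *-identityʳ _ ⟩
    - m * d + m * d         ≈⟨ distribʳ d (- m) m ⟨
    (- m + m) * d           ≈⟨ *-congʳ (-‿inverseˡ m) ⟩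
    0# * d                  ≈⟨ zeroˡ d ⟩
    0#                      ≈⟨ zeroˡ (d * d) ⟨
    0# * (d * d)            ∎)

  *ᶠ-assoc : ∀ x y z → (x *ᶠ y) *ᶠ z ≈ᶠ x *ᶠ (y *ᶠ z)
  *ᶠ-assoc (fraction m d _) (fraction n e _) (fraction o f _) =
    cross (*-cong (*-assoc m n o) (sym (*-assoc d e f)))

  *ᶠ-comm : ∀ x y → x *ᶠ y ≈ᶠ y *ᶠ x
  *ᶠ-comm (fraction m d _) (fraction n e _) =
    cross (*-cong (*-comm m n) (*-comm e d))

  *ᶠ-identityˡ : ∀ x → 1ᶠ *ᶠ x ≈ᶠ x
  *ᶠ-identityˡ (fraction m d _) =
    cross (*-cong (*-identityˡ m) (sym (*-identityˡ d)))

  *ᶠ-distribˡ : ∀ x y z → x *ᶠ (y +ᶠ z) ≈ᶠ x *ᶠ y +ᶠ x *ᶠ z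
  *ᶠ-distribˡ (fraction m d _) (fraction n e _) (fraction o f _) =
    cross (distrib-id m d n e o f)

  fractionRing : CommutativeRing (c ⊔ ℓ) ℓ
  fractionRing = record
    { Carrier = Fraction
    ; _≈_ = _≈ᶠ_
    ; _+_ = _+ᶠ_
    ; _*_ = _*ᶠ_
    ; -_ = -ᶠ_
    ; 0# = 0ᶠ
    ; 1# = 1ᶠ
    ; isCommutativeRing = record
      { isRing = record
        { +-isAbelianGroup = record
          { isGroup = record
            { isMonoid = record
              { isSemigroup = record
                { isMagma = record
                  { isEquivalence = record
                    { refl  = cross refl
                    ; sym   = λ e → cross (sym (uncross e))
                    ; trans = transᶠ
                    }
                  ; ∙-cong = +ᶠ-cong
                  }
                ; assoc = +ᶠ-assoc
                }
              ; identity = +ᶠ-identityˡ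
                         , λ x → transᶠ (+ᶠ-comm x 0ᶠ) (+ᶠ-identityˡ x)
              }
            ; inverse = -ᶠ-inverseˡ
                      , λ x → transᶠ (+ᶠ-comm x (-ᶠ x)) (-ᶠ-inverseˡ x)
            ; ⁻¹-cong = -ᶠ-cong
            }
          ; comm = +ᶠ-comm
          }
        ; *-cong = *ᶠ-cong
        ; *-assoc = *ᶠ-assoc
        ; *-identity = *ᶠ-identityˡ
                     , λ x → transᶠ (*ᶠ-comm x 1ᶠ) (*ᶠ-identityˡ x)
        ; distrib = *ᶠ-distribˡ , λ x y z →
            transᶠ (*ᶠ-comm (y +ᶠ z) x)
            (transᶠ (*ᶠ-distribˡ x y z) (+ᶠ-cong (*ᶠ-comm x y) (*ᶠ-comm x z)))
        }
      ; *-comm = *ᶠ-comm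
      }
    }

  _≟ᶠ_ : Decidable _≈ᶠ_
  x ≟ᶠ y with num x * den y ≟ num y * den x
  ... | yes e = yes (cross e)
  ... | no ¬e = no λ g → ¬e (uncross g)

  num≈0⇒≈0 : ∀ x → num x ≈ 0# → x ≈ᶠ 0ᶠ
  num≈0⇒≈0 x e =
    cross (trans (*-identityʳ _) (trans e (sym (zeroˡ _))))

  ≈0⇒num≈0 : ∀ x → x ≈ᶠ 0ᶠ → num x ≈ 0#
  ≈0⇒num≈0 x e =
    trans (sym (*-identityʳ _)) (trans (uncross e) (zeroˡ _))

  *ᶠ-inverseʳ : ∀ x → ¬ x ≈ᶠ 0ᶠ → x *ᶠ x ⁻¹ᶠ ≈ᶠ 1ᶠ
  *ᶠ-inverseʳ x@(fraction m d d≉0) x≉0 with m ≟ 0#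
  ... | yes m≈0 = ⊥-elim (x≉0 (num≈0⇒≈0 x m≈0))
  ... | no  m≉0 = cross (inverse-id m d)

  0⁻¹ᶠ≈0 : ∀ x → x ≈ᶠ 0ᶠ → x ⁻¹ᶠ ≈ᶠ 0ᶠ
  0⁻¹ᶠ≈0 x@(fraction m d d≉0) x≈0 with m ≟ 0#
  ... | yes _   = cross refl
  ... | no  m≉0 = ⊥-elim (m≉0 (≈0⇒num≈0 x x≈0))

  fractionField : DiscreteField (c ⊔ ℓ) ℓ
  fractionField = record
    { commutativeRing = fractionRing
    ; _≟_             = _≟ᶠ_
    ; 1≉0             = λ e → 1≉0 (≈0⇒num≈0 1ᶠ e)
    ; _⁻¹             = _⁻¹ᶠ
    ; *-inverseʳ      = *ᶠ-inverseʳ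
    ; 0⁻¹≈0           = 0⁻¹ᶠ≈0
    }

  ι-cong : ∀ {x y} → x ≈ y → ι x ≈ᶠ ι y
  ι-cong e = cross (*-congʳ e)

  ι-injective : ∀ {x y} → ι x ≈ᶠ ι y → x ≈ y
  ι-injective e =
    trans (sym (*-identityʳ _)) (trans (uncross e) (*-identityʳ _))

  ι-* : ∀ x y → ι x *ᶠ ι y ≈ᶠ ι (x * y)
  ι-* x y = cross (*-congˡ (sym (*-identityˡ 1#)))

  ι-+ : ∀ x y → ι x +ᶠ ι y ≈ᶠ ι (x + y)
  ι-+ x y = cross (*-cong (+-cong (*-identityʳ x) (*-identityʳ y))
                          (sym (*-identityˡ 1#)))

module Moments {c ℓ} (F : DiscreteField c ℓ)
               (a b q : DiscreteField.Carrier F) where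
  open DiscreteField F
  open RingNotation commutativeRing

  μ : ℕ → Carrier
  μ m = ⟨ a * q ⨾ q ⟩ m / ⟨ a * b * q ^ 2 ⨾ q ⟩ m

-- Rational functions in the indeterminates a, b, q form the field of
-- fractions of D[a][b][q]; for D = ℤ or D = ℚ this is ℚ(a, b, q).
module RationalFunctions {c ℓ} (D : DiscreteDomain c ℓ) where
  module P₁ = Polynomial D
  module P₂ = Polynomial P₁.polyDomain
  module P₃ = Polynomial P₂.polyDomain
  module Fr = FractionField P₃.polyDomain

  rationalFunctions : DiscreteField (c ⊔ ℓ) ℓ
  rationalFunctions = Fr.fractionField

  open DiscreteField rationalFunctions public
  open RingNotation commutativeRing public

  a b q : Carrier
  a = Fr.ι (P₃.const (P₂.const P₁.X))
  b = Fr.ι (P₃.const P₂.X)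
  q = Fr.ι P₃.X

  open Moments rationalFunctions a b q public

  -- The denominators in the moments and in the determinant formula are
  -- nonzero: as polynomials in q they have constant term 1.
  module K = DiscreteDomain P₂.polyDomain
  module R = DiscreteDomain P₃.polyDomain

  record ConstantTerm (x : Carrier) (t : K.Carrier) : Set (c ⊔ ℓ) where
    constructor constantTerm
    field
      poly    : R.Carrier
      x≈poly  : x ≈ Fr.ι poly
      coeff₀  : P₃.coeff poly 0 K.≈ t

  ct-≈ : ∀ {x s t} → s K.≈ t → ConstantTerm x s → ConstantTerm x t
  ct-≈ s≈t (constantTerm p e f) = constantTerm p e (K.trans f s≈t)

  ct-* : ∀ {x y s t} →
         ConstantTerm x s → ConstantTerm y t → ConstantTerm (x * y) (s K.* t)
  ct-* (constantTerm p e f) (constantTerm r g h) = constantTerm (p R.* r)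
    (trans (*-cong e g) (Fr.ι-* p r)) (K.trans (coeff₀-* p r) (K.*-cong f h))
    where
    coeff₀-* : ∀ p r → P₃.coeff (p R.* r) 0 K.≈ P₃.coeff p 0 K.* P₃.coeff r 0
    coeff₀-* []      r = K.sym (K.zeroˡ (P₃.coeff r 0))
    coeff₀-* (u ∷ p) r =
      K.trans (P₃.coeff-+ (u P₃.· r) (K.0# ∷ p R.* r) 0)
      (K.trans (K.+-identityʳ _) (P₃.coeff-· u r 0))

  ct-0*ˡ : ∀ {x y t} →
           ConstantTerm x K.0# → ConstantTerm y t → ConstantTerm (x * y) K.0#
  ct-0*ˡ {t = t} cx cy = ct-≈ (K.zeroˡ t) (ct-* cx cy)

  ct-0*ʳ : ∀ {x y s} →
           ConstantTerm x s → ConstantTerm y K.0# → ConstantTerm (x * y) K.0#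
  ct-0*ʳ {s = s} cx cy = ct-≈ (K.zeroʳ s) (ct-* cx cy)

  ct-1- : ∀ {x} → ConstantTerm x K.0# → ConstantTerm (1# - x) K.1#
  ct-1- {x} (constantTerm p e f) = constantTerm (R.1# R.- p)
    (trans (+-congˡ {1#} (-‿cong {x} {Fr.ι p} e)) (Fr.ι-+ R.1# (R.- p)))
    (K.trans (P₃.coeff-+ R.1# (R.- p) 0)
    (K.trans (K.+-congˡ (K.trans (P₃.coeff-neg p 0)
      (K.trans (K.-‿cong f) -0#≈0#))) (K.+-identityʳ K.1#)))
    where open RingProperties K.ring using (-0#≈0#)

  ct-1 : ConstantTerm 1# K.1#
  ct-1 = constantTerm R.1# refl K.refl

  ct-q : ConstantTerm q K.0#
  ct-q = constantTerm P₃.X refl K.refl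

  ct-q^ : ∀ k → ∃ λ t → ConstantTerm (q ^ k) t
  ct-q^ zero    = _ , ct-1
  ct-q^ (suc k) = _ , ct-* ct-q (proj₂ (ct-q^ k))

  ct-product : ∀ m (f : Vector Carrier m) →
               (∀ i → ConstantTerm (f i) K.1#) → ConstantTerm (product f) K.1#
  ct-product zero    f h = ct-1
  ct-product (suc m) f h = ct-≈ (K.*-identityˡ K.1#)
    (ct-* (h zero) (ct-product m (λ i → f (suc i)) (λ i → h (suc i))))

  ct-1⇒≉0 : ∀ {x} → ConstantTerm x K.1# → ¬ x ≈ 0#
  ct-1⇒≉0 (constantTerm p e f) x≈0 = K.1≉0 (K.trans (K.sym f)
    (P₃.at (Fr.ι-injective (trans (sym e) x≈0)) 0))

  denominator≉0 : ∀ i m → ¬ ⟨ a * b * q ^ suc i ⨾ q ⟩ m ≈ 0#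
  denominator≉0 i m = ct-1⇒≉0 (ct-product m _ λ k →
    ct-1- (ct-0*ˡ (ct-0*ʳ (ct-* ct-a ct-b) (ct-0*ˡ ct-q (proj₂ (ct-q^ i))))
                  (proj₂ (ct-q^ (toℕ k)))))
    where
    ct-a : ConstantTerm a (P₂.const P₁.X)
    ct-a = constantTerm _ refl K.refl
    ct-b : ConstantTerm b P₂.X
    ct-b = constantTerm _ refl K.refl

{-# OPTIONS --safe #-}
module Submission where

-- Write A = aq and C = abq². Subtracting (1 - Aqʲ)/(1 - Cqʲ) times column j
-- from column j + 1, for all j, clears the first row of the Hankel matrix but
-- for its leading 1, and the remaining minor is, up to row and column factors,
-- the Hankel matrix of the moments for aq and bq in place of a and b. The
-- claimed pivots pₘ(a, b) satisfy the matching recursion: pₘ₊₁(a, b)/pₘ(aq, bq)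
-- is the product of the m-th row and column factors.

open import Algebra.Bundles using (CommutativeRing)
import Algebra.Properties.CommutativeMonoid.Sum as CommutativeMonoidSum
import Algebra.Properties.CommutativeSemiring.Exp as Exponentiation
import Algebra.Properties.Ring as RingProperties
import Algebra.Properties.Semiring.Sum as SemiringSum
import Algebra.Solver.Ring.NaturalCoefficients.Default as NaturalCoefficients
open import Data.Empty using (⊥-elim)
open import Data.Fin.Base using (Fin; zero; suc; toℕ; fromℕ<; inject₁; punchIn; punchOut)
import Data.Fin.Properties as Fin
open import Data.Nat.Base as ℕ using (ℕ; zero; suc; NonZero; _∸_)
import Data.Nat.DivMod as ℕ
import Data.Nat.Properties as ℕ
open import Data.Nat.Solver using (module +-*-Solver)
open import Data.Product.Base using (∃; _×_; _,_)
open import Data.Sum.Base using (_⊎_; inj₁; inj₂)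
open import Data.Vec.Functional using (Vector; updateAt)
open import Data.Vec.Functional.Properties using (updateAt-updates; updateAt-minimal)
open import Defs
open import Function.Base using (_∘_)
open import Relation.Binary.PropositionalEquality as ≡ using (_≡_; _≢_)
import Relation.Binary.Reasoning.Setoid as SetoidReasoning
open import Relation.Nullary.Decidable using (Dec; yes; no)
open import Relation.Nullary.Negation using (¬_)

-- Adjacent columns under the deletion of a column.

-- For minors of a matrix with two equal adjacent columns: if the deleted column is neither of them,
-- the minor again has two equal adjacent columns, and induction applies.
punchIn-keeps-adjacent : ∀ {n} (j : Fin (suc (suc n))) (k : Fin (suc n)) →
  j ≢ inject₁ k → j ≢ suc k →
  ∃ λ i → punchIn j (inject₁ i) ≡ inject₁ k × punchIn j (suc i) ≡ suc k
punchIn-keeps-adjacent         zero          zero    j≢k _    = ⊥-elim (j≢k ≡.refl)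
punchIn-keeps-adjacent         zero          (suc k) _   _    = k , ≡.refl , ≡.refl
punchIn-keeps-adjacent         (suc zero)    zero    _   j≢k⁺ = ⊥-elim (j≢k⁺ ≡.refl)
punchIn-keeps-adjacent {suc n} (suc (suc j)) zero    _   _    = zero , ≡.refl , ≡.refl
punchIn-keeps-adjacent {suc n} (suc j)       (suc k) j≢k j≢k⁺
  with i , e , f ← punchIn-keeps-adjacent j k (j≢k ∘ ≡.cong suc) (j≢k⁺ ∘ ≡.cong suc)
  = suc i , ≡.cong suc e , ≡.cong suc f

-- Deleting either of two neighbours leaves the other one in the same position, and only there do
-- the two embeddings differ. If the neighbours are equal columns, the two minors therefore agree.
punchIn-adjacent : ∀ {n} (k i : Fin n) →
  punchIn (inject₁ k) i ≡ punchIn (suc k) i ⊎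
  (punchIn (inject₁ k) i ≡ suc k × punchIn (suc k) i ≡ inject₁ k)
punchIn-adjacent zero    zero    = inj₂ (≡.refl , ≡.refl)
punchIn-adjacent zero    (suc i) = inj₁ ≡.refl
punchIn-adjacent (suc k) zero    = inj₁ ≡.refl
punchIn-adjacent (suc k) (suc i) with punchIn-adjacent k i
... | inj₁ e       = inj₁ (≡.cong suc e)
... | inj₂ (e , f) = inj₂ (≡.cong suc e , ≡.cong suc f)

-- Column operations on determinants defined by Laplace expansion.

module Determinant {c ℓ} (R : CommutativeRing c ℓ) where
  open CommutativeRing R hiding (zero)
  open RingNotation R
  open SemiringSum semiring using (sum-cong-≋; sum-replicate-zero; ∑-distrib-+; *-distribˡ-sum)
  open CommutativeMonoidSum *-commutativeMonoid using ()
    renaming (sum-remove to product-remove)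
  open NaturalCoefficients commutativeSemiring
  open SetoidReasoning setoid

  sum-zero : ∀ {n} (f : Vector Carrier n) → (∀ i → f i ≈ 0#) → sum f ≈ 0#
  sum-zero {n} f h = trans (sum-cong-≋ h) (sum-replicate-zero n)

  -- The shape of a Laplace expansion with two equal adjacent columns: only the terms at those
  -- columns survive, and they cancel.
  sum-adjacent-cancel : ∀ {n} (k : Fin n) (f : Vector Carrier (suc n)) →
    (∀ j → j ≢ inject₁ k → j ≢ suc k → f j ≈ 0#) →
    f (inject₁ k) + f (suc k) ≈ 0# → sum f ≈ 0#
  sum-adjacent-cancel zero f h e = begin
    f zero + (f (suc zero) + sum (λ i → f (suc (suc i))))
      ≈⟨ +-assoc _ _ _ ⟨
    f zero + f (suc zero) + sum (λ i → f (suc (suc i)))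
      ≈⟨ +-cong e (sum-zero _ λ i → h (suc (suc i)) (λ ()) (λ ())) ⟩
    0# + 0#
      ≈⟨ +-identityʳ 0# ⟩
    0# ∎
  sum-adjacent-cancel (suc k) f h e = trans
    (+-cong (h zero (λ ()) (λ ()))
            (sum-adjacent-cancel k (f ∘ suc)
              (λ j j≢k j≢k⁺ → h (suc j) (j≢k ∘ Fin.suc-injective) (j≢k⁺ ∘ Fin.suc-injective)) e))
    (+-identityʳ 0#)

  det-cong : ∀ {n} {A B : Matrix n} → (∀ i j → A i j ≈ B i j) → det A ≈ det B
  det-cong {zero}  h = refl
  det-cong {suc n} h = sum-cong-≋ λ j →
    *-cong (*-congˡ {(- 1#) ^ toℕ j} (h zero j)) (det-cong λ i k → h (suc i) (punchIn j k))

  -- In the term at column `k` the three minors coincide and the entry splits. In any other term the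
  -- entries coincide and the minor splits by induction, column `k` having moved to position
  -- `punchOut j≢k`.
  det-linear : ∀ {n} (k : Fin n) x {A B C : Matrix n} →
    (∀ i j → j ≢ k → A i j ≈ C i j) → (∀ i j → j ≢ k → B i j ≈ C i j) →
    (∀ i → C i k ≈ A i k + x * B i k) → det C ≈ det A + x * det B
  det-linear {suc n} k x {A} {B} {C} A≈C B≈C C≈A+xB = begin
    det C                                       ≈⟨ sum-cong-≋ (λ j → term j (j Fin.≟ k)) ⟩
    sum (λ j → summand A j + x * summand B j)   ≈⟨ ∑-distrib-+ (summand A) (λ j → x * summand B j) ⟩
    det A + sum (λ j → x * summand B j)         ≈⟨ +-congˡ (*-distribˡ-sum x (summand B)) ⟨
    det A + x * det B                           ∎
    where
    summand : Matrix (suc n) → Fin (suc n) → Carrier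
    summand M j = (- 1#) ^ toℕ j * M zero j * det (minor M j)

    term : ∀ j → Dec (j ≡ k) → summand C j ≈ summand A j + x * summand B j
    term j (yes ≡.refl) = begin
      s * C zero j * m
        ≈⟨ *-congʳ (*-congˡ (C≈A+xB zero)) ⟩
      s * (A zero j + x * B zero j) * m
        ≈⟨ solve 5 (λ s u x v m → s :* (u :+ x :* v) :* m := s :* u :* m :+ x :* (s :* v :* m))
             refl s (A zero j) x (B zero j) m ⟩
      s * A zero j * m + x * (s * B zero j * m)
        ≈⟨ +-cong (*-congˡ (minor≈ A≈C)) (*-congˡ (*-congˡ (minor≈ B≈C))) ⟨
      summand A j + x * summand B j ∎
      where
      s = (- 1#) ^ toℕ j
      m = det (minor C j)
      minor≈ : ∀ {M} → (∀ i j′ → j′ ≢ j → M i j′ ≈ C i j′) → det (minor M j) ≈ m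
      minor≈ h = det-cong λ i l → h (suc i) (punchIn j l) (Fin.punchInᵢ≢i j l)
    term j (no j≢k) = begin
      s * C zero j * det (minor C j)
        ≈⟨ *-congˡ (det-linear k′ x (off A≈C) (off B≈C) at-k′) ⟩
      s * C zero j * (mA + x * mB)
        ≈⟨ solve 5 (λ s u x m n → s :* u :* (m :+ x :* n) := s :* u :* m :+ x :* (s :* u :* n))
             refl s (C zero j) x mA mB ⟩
      s * C zero j * mA + x * (s * C zero j * mB)
        ≈⟨ +-cong (*-congʳ (*-congˡ (A≈C zero j j≢k)))
                  (*-congˡ (*-congʳ (*-congˡ (B≈C zero j j≢k)))) ⟨
      summand A j + x * summand B j ∎
      where
      s  = (- 1#) ^ toℕ j
      mA = det (minor A j)
      mB = det (minor B j)
      k′ = punchOut j≢k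
      k′-spec : punchIn j k′ ≡ k
      k′-spec = Fin.punchIn-punchOut j≢k
      off : ∀ {M} → (∀ i j′ → j′ ≢ k → M i j′ ≈ C i j′) →
            ∀ i l → l ≢ k′ → minor M j i l ≈ minor C j i l
      off h i l l≢k′ = h (suc i) (punchIn j l) λ e →
        l≢k′ (Fin.punchIn-injective j l k′ (≡.trans e (≡.sym k′-spec)))
      at-k′ : ∀ i → minor C j i k′ ≈ minor A j i k′ + x * minor B j i k′
      at-k′ i = ≡.subst (λ l → C (suc i) l ≈ A (suc i) l + x * B (suc i) l)
                        (≡.sym k′-spec) (C≈A+xB (suc i))

  -- A minor that keeps both equal columns still has them adjacent and vanishes by induction. The
  -- two remaining minors coincide and occur with opposite signs.
  det-adjacent-equal : ∀ {n} (k : Fin n) {A : Matrix (suc n)} →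
    (∀ i → A i (inject₁ k) ≈ A i (suc k)) → det A ≈ 0#
  det-adjacent-equal {suc n} k {A} h = sum-adjacent-cancel k _ others pair
    where
    others : ∀ j → j ≢ inject₁ k → j ≢ suc k →
             (- 1#) ^ toℕ j * A zero j * det (minor A j) ≈ 0#
    others j j≢k j≢k⁺ with i , e , f ← punchIn-keeps-adjacent j k j≢k j≢k⁺ =
      trans (*-congˡ (det-adjacent-equal i {minor A j} λ r →
        ≡.subst₂ (λ u v → A (suc r) u ≈ A (suc r) v) (≡.sym e) (≡.sym f) (h (suc r))))
      (zeroʳ _)

    minors-equal : ∀ r i → minor A (inject₁ k) r i ≈ minor A (suc k) r i
    minors-equal r i with punchIn-adjacent k i
    ... | inj₁ e       = reflexive (≡.cong (A (suc r)) e)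
    ... | inj₂ (e , f) = ≡.subst₂ (λ u v → A (suc r) u ≈ A (suc r) v)
                           (≡.sym e) (≡.sym f) (sym (h (suc r)))

    pair : (- 1#) ^ toℕ (inject₁ k) * A zero (inject₁ k) * det (minor A (inject₁ k))
         + (- 1#) ^ toℕ (suc k) * A zero (suc k) * det (minor A (suc k)) ≈ 0#
    pair = begin
      (- 1#) ^ toℕ (inject₁ k) * A zero (inject₁ k) * det (minor A (inject₁ k)) + - 1# * s * u * m
        -- `inject₁ k` has the same value as `k`, so its sign lacks just one factor `- 1#` of the
        -- sign at `suc k`.
        ≈⟨ +-congʳ (*-cong (*-cong (reflexive (≡.cong ((- 1#) ^_) (Fin.toℕ-inject₁ k))) (h zero))
                           (det-cong minors-equal)) ⟩
      s * u * m + - 1# * s * u * m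
        ≈⟨ solve 4 (λ s u m e → s :* u :* m :+ e :* s :* u :* m := (con 1 :+ e) :* (s :* u :* m))
             refl s u m (- 1#) ⟩
      (1# + - 1#) * (s * u * m)
        ≈⟨ *-congʳ (-‿inverseʳ 1#) ⟩
      0# * (s * u * m)
        ≈⟨ zeroˡ _ ⟩
      0# ∎
      where
      s = (- 1#) ^ toℕ k
      u = A zero (suc k)
      m = det (minor A (suc k))

  -- Linearity in column `suc k` splits off `x` times the determinant of `A′`, which has column `k`
  -- of `A` in two adjacent places.
  det-addColumn : ∀ {n} (k : Fin n) x {A B : Matrix (suc n)} →
    (∀ i j → j ≢ suc k → A i j ≈ B i j) →
    (∀ i → B i (suc k) ≈ A i (suc k) + x * A i (inject₁ k)) →
    det B ≈ det A
  det-addColumn {n} k x {A} {B} A≈B B≈A+xA = begin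
    det B
      ≈⟨ det-linear (suc k) x A≈B
           (λ i j j≢k⁺ → trans (reflexive (off i j j≢k⁺)) (A≈B i j j≢k⁺))
           (λ i → trans (B≈A+xA i) (+-congˡ (*-congˡ (reflexive (≡.sym (on i)))))) ⟩
    det A + x * det A′
      ≈⟨ +-congˡ (*-congˡ (det-adjacent-equal k {A′} λ i →
           reflexive (≡.trans (off i (inject₁ k) k≢k⁺) (≡.sym (on i))))) ⟩
    det A + x * 0#
      ≈⟨ trans (+-congˡ (zeroʳ x)) (+-identityʳ _) ⟩
    det A ∎
    where
    A′ : Matrix (suc n)
    A′ i = updateAt (A i) (suc k) λ _ → A i (inject₁ k)
    on : ∀ i → A′ i (suc k) ≡ A i (inject₁ k)
    on i = updateAt-updates (suc k) (A i)
    off : ∀ i j → j ≢ suc k → A′ i j ≡ A i j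
    off i j j≢k⁺ = updateAt-minimal j (suc k) (A i) j≢k⁺
    k≢k⁺ : inject₁ k ≢ suc k
    k≢k⁺ e = ℕ.1+n≢n (≡.trans (≡.sym (≡.cong toℕ e)) (Fin.toℕ-inject₁ k))

  -- Deleting column `j` loses exactly the factor `s j`, and the first-row entry restores it, so all
  -- terms of the expansion carry the same factor.
  det-scale : ∀ {n} (r s : Vector Carrier n) (A : Matrix n) →
    det (λ i j → r i * s j * A i j) ≈ product r * product s * det A
  det-scale {zero}  r s A = sym (trans (*-identityʳ _) (*-identityʳ _))
  det-scale {suc n} r s A = begin
    sum (λ j → ε j * (r zero * s j * A zero j) * det (λ i l → r (suc i) * s (punchIn j l) * minor A j i l))
      ≈⟨ sum-cong-≋ term ⟩
    sum (λ j → product r * product s * (ε j * A zero j * det (minor A j)))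
      ≈⟨ *-distribˡ-sum (product r * product s) (λ j → ε j * A zero j * det (minor A j)) ⟨
    product r * product s * det A ∎
    where
    ε : Fin (suc n) → Carrier
    ε j = (- 1#) ^ toℕ j
    term : ∀ j → ε j * (r zero * s j * A zero j) * det (λ i l → r (suc i) * s (punchIn j l) * minor A j i l)
                 ≈ product r * product s * (ε j * A zero j * det (minor A j))
    term j = begin
      ε j * (r zero * s j * A zero j) * det (λ i l → r (suc i) * s (punchIn j l) * minor A j i l)
        ≈⟨ *-congˡ (det-scale (r ∘ suc) (s ∘ punchIn j) (minor A j)) ⟩
      ε j * (r zero * s j * A zero j) * (product (r ∘ suc) * product (s ∘ punchIn j) * det (minor A j))
        ≈⟨ solve 7 (λ e r₀ sⱼ a r′ s′ d → e :* (r₀ :* sⱼ :* a) :* (r′ :* s′ :* d)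
                                     := r₀ :* r′ :* (sⱼ :* s′) :* (e :* a :* d))
             refl (ε j) (r zero) (s j) (A zero j) (product (r ∘ suc)) (product (s ∘ punchIn j)) (det (minor A j)) ⟩
      product r * (s j * product (s ∘ punchIn j)) * (ε j * A zero j * det (minor A j))
        ≈⟨ *-congʳ (*-congˡ (product-remove {i = j} s)) ⟨
      product r * product s * (ε j * A zero j * det (minor A j)) ∎

  det-firstRow : ∀ {n} (A : Matrix (suc n)) → A zero zero ≈ 1# → (∀ j → A zero (suc j) ≈ 0#) →
    det A ≈ det (minor A zero)
  det-firstRow A h₀ h = begin
    1# * A zero zero * det (minor A zero) + _
      ≈⟨ +-cong (*-congʳ (trans (*-identityˡ _) h₀))
                (sum-zero _ λ j → trans (*-congʳ (trans (*-congˡ (h j)) (zeroʳ _))) (zeroˡ _)) ⟩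
    1# * det (minor A zero) + 0#
      ≈⟨ trans (+-identityʳ _) (*-identityˡ _) ⟩
    det (minor A zero) ∎

  -- Adding the multiples from right to left keeps each added column intact;
  -- at stage t the multiples have been added to the columns beyond t only.
  det-addColumns : ∀ {n} (x : Vector Carrier n) (A B : Matrix (suc n)) →
    (∀ i → B i zero ≈ A i zero) →
    (∀ i j → B i (suc j) ≈ A i (suc j) + x j * A i (inject₁ j)) →
    det B ≈ det A
  det-addColumns {n} x A B h₀ h =
    trans (det-cong B≈stage-0) (trans (climb n ℕ.≤-refl) (det-cong stage-n≈A))
    where
    stage : ℕ → Matrix (suc n)
    stage t i zero    = A i zero
    stage t i (suc j) with toℕ j ℕ.<? t
    ... | yes _ = A i (suc j)
    ... | no  _ = A i (suc j) + x j * A i (inject₁ j)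

    B≈stage-0 : ∀ i j → B i j ≈ stage 0 i j
    B≈stage-0 i zero    = h₀ i
    B≈stage-0 i (suc j) with toℕ j ℕ.<? 0
    ... | no _ = h i j

    below : ∀ t i j → toℕ j ℕ.≤ t → stage t i j ≡ A i j
    below t i zero    _   = ≡.refl
    below t i (suc j) j<t with toℕ j ℕ.<? t
    ... | yes _   = ≡.refl
    ... | no  j≮t = ⊥-elim (j≮t j<t)

    stage-n≈A : ∀ i j → stage n i j ≈ A i j
    stage-n≈A i j = reflexive (below n i j (Fin.toℕ≤pred[n] j))

    step : ∀ k → det (stage (toℕ k)) ≈ det (stage (suc (toℕ k)))
    step k = det-addColumn k (x k) {stage (suc (toℕ k))} {stage (toℕ k)} off on
      where
      off : ∀ i j → j ≢ suc k → stage (suc (toℕ k)) i j ≈ stage (toℕ k) i j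
      off i zero    _ = refl
      off i (suc j) j≢k with toℕ j ℕ.<? toℕ k | toℕ j ℕ.<? suc (toℕ k)
      ... | yes _   | yes _  = refl
      ... | no  _   | no _   = refl
      ... | yes j<k | no j≮  = ⊥-elim (j≮ (ℕ.m<n⇒m<1+n j<k))
      ... | no  j≮k | yes j≤ = ⊥-elim (j≢k (≡.cong suc (Fin.toℕ-injective
                                 (ℕ.≤-antisym (ℕ.s≤s⁻¹ j≤) (ℕ.≮⇒≥ j≮k)))))
      on : ∀ i → stage (toℕ k) i (suc k) ≈
                 stage (suc (toℕ k)) i (suc k) + x k * stage (suc (toℕ k)) i (inject₁ k)
      on i with toℕ k ℕ.<? toℕ k
      ... | yes k<k = ⊥-elim (ℕ.<-irrefl ≡.refl k<k)
      ... | no _    = sym (+-cong (reflexive (below _ i (suc k) ℕ.≤-refl))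
                        (*-congˡ (reflexive (below _ i (inject₁ k)
                          (ℕ.≤-trans (ℕ.≤-reflexive (Fin.toℕ-inject₁ k)) (ℕ.n≤1+n _))))))

    climb : ∀ t → t ℕ.≤ n → det (stage 0) ≈ det (stage t)
    climb zero    _   = refl
    climb (suc t) t<n = trans (climb t (ℕ.<⇒≤ t<n))
      (≡.subst (λ m → det (stage m) ≈ det (stage (suc m))) (Fin.toℕ-fromℕ< t<n) (step (fromℕ< t<n)))

-- The exponents of `a` and `q`.

-- The sums of `m` and of `m * m` over `m < n`, to which the exponents in `a ^ m` and `q ^ (m * m)`
-- add up over the first `n` pivots.
triangular pyramidal : ℕ → ℕ
triangular zero    = 0
triangular (suc n) = n ℕ.+ triangular n
pyramidal zero    = 0
pyramidal (suc n) = n ℕ.* n ℕ.+ pyramidal n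

-- The numerator is exactly twice the sum, so the truncating division loses nothing.
triangular-closed : ∀ n → n ℕ.* (n ∸ 1) ℕ./ 2 ≡ triangular n
triangular-closed n = ≡.trans (≡.cong (ℕ._/ 2) (double n)) (ℕ.m*n/n≡m (triangular n) 2)
  where
  open +-*-Solver
  double : ∀ n → n ℕ.* (n ∸ 1) ≡ triangular n ℕ.* 2
  double zero          = ≡.refl
  double (suc zero)    = ≡.refl
  -- The induction hypothesis is taken at `suc n`, where the truncated `suc n ∸ 1` computes to `n`;
  -- hence the two base cases.
  double (suc (suc n)) = ≡.trans
    (solve 1 (λ n → (con 2 :+ n) :* (con 1 :+ n) :=
                    (con 1 :+ n) :* n :+ (con 1 :+ n) :* con 2) ≡.refl n)
    (≡.trans (≡.cong (ℕ._+ suc n ℕ.* 2) (double (suc n)))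
    (solve 2 (λ n t → t :* con 2 :+ (con 1 :+ n) :* con 2 :=
                      (con 1 :+ n :+ t) :* con 2) ≡.refl n (triangular (suc n))))

-- The same argument with six in place of two; `odd` first turns the truncated difference into a
-- polynomial.
pyramidal-closed : ∀ n → n ℕ.* (n ∸ 1) ℕ.* (2 ℕ.* n ∸ 1) ℕ./ 6 ≡ pyramidal n
pyramidal-closed n = ≡.trans (≡.cong (ℕ._/ 6) (sextuple n)) (ℕ.m*n/n≡m (pyramidal n) 6)
  where
  open +-*-Solver
  odd : ∀ n → 2 ℕ.* suc n ∸ 1 ≡ 1 ℕ.+ 2 ℕ.* n
  odd n = ℕ.+-suc n (n ℕ.+ 0)
  sextuple : ∀ n → n ℕ.* (n ∸ 1) ℕ.* (2 ℕ.* n ∸ 1) ≡ pyramidal n ℕ.* 6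
  sextuple zero          = ≡.refl
  sextuple (suc zero)    = ≡.refl
  sextuple (suc (suc n)) = ≡.trans
    (≡.cong (suc (suc n) ℕ.* suc n ℕ.*_) (odd (suc n))) (≡.trans
    (solve 1 (λ n → (con 2 :+ n) :* (con 1 :+ n) :* (con 1 :+ con 2 :* (con 1 :+ n)) :=
                    (con 1 :+ n) :* n :* (con 1 :+ con 2 :* n)
                      :+ (con 1 :+ n) :* (con 1 :+ n) :* con 6) ≡.refl n)
    (≡.trans (≡.cong (ℕ._+ suc n ℕ.* suc n ℕ.* 6)
      (≡.trans (≡.cong (suc n ℕ.* n ℕ.*_) (≡.sym (odd n))) (sextuple (suc n))))
    (solve 2 (λ n p → p :* con 6 :+ (con 1 :+ n) :* (con 1 :+ n) :* con 6 :=
                      ((con 1 :+ n) :* (con 1 :+ n) :+ p) :* con 6) ≡.refl n (pyramidal (suc n)))))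

-- Identities for `q`-shifted factorials.

module ShiftedFactorial {c ℓ} (R : CommutativeRing c ℓ) where
  open CommutativeRing R hiding (zero)
  open RingNotation R
  open RingProperties ring using (-1*x≈-x)
  open CommutativeMonoidSum *-commutativeMonoid using ()
    renaming (sum-cong-≋ to product-cong; ∑-distrib-+ to product-distrib-*) public
  open NaturalCoefficients commutativeSemiring
  open SetoidReasoning setoid

  product-snoc : ∀ n (f : ℕ → Carrier) →
    product {suc n} (λ i → f (toℕ i)) ≈ product {n} (λ i → f (toℕ i)) * f n
  product-snoc zero    f = *-comm (f 0) 1#
  product-snoc (suc n) f = trans (*-congˡ (product-snoc n λ i → f (suc i))) (sym (*-assoc _ _ _))

  1-‿cong : ∀ {x y} → x ≈ y → 1# - x ≈ 1# - y
  1-‿cong e = +-congˡ (-‿cong e)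

  ⟨⟩-cong : ∀ {x y} q m → x ≈ y → ⟨ x ⨾ q ⟩ m ≈ ⟨ y ⨾ q ⟩ m
  ⟨⟩-cong q m e = product-cong {m} λ k → 1-‿cong (*-congʳ e)

  ⟨⟩-snoc : ∀ x q m → ⟨ x ⨾ q ⟩ (suc m) ≈ ⟨ x ⨾ q ⟩ m * (1# - x * q ^ m)
  ⟨⟩-snoc x q m = product-snoc m λ k → 1# - x * q ^ k

  -- Removing the first factor moves the base from `x` to `x * q`; this is how the parameters
  -- `a * q` and `b * q` arise.
  ⟨⟩-cons : ∀ x q m → ⟨ x ⨾ q ⟩ (suc m) ≈ (1# - x) * ⟨ x * q ⨾ q ⟩ m
  ⟨⟩-cons x q m = *-cong (1-‿cong (*-identityʳ x))
    (product-cong {m} λ k → 1-‿cong (sym (*-assoc x q (q ^ toℕ k))))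

  -- With ν for -1, both sides differ by a multiple of 1 + ν, and only then
  -- is the identity one of semirings.
  cross-difference : ∀ x y u v →
    (1# - x * (u * v)) * (1# - x * y * v) - (1# - x * v) * (1# - x * y * (u * v))
      ≈ (1# - u) * (v * (x * (1# - y)))
  cross-difference x y u v = begin
    (1# - x * (u * v)) * (1# - x * y * v) - (1# - x * v) * (1# - x * y * (u * v))
      ≈⟨ +-cong (*-cong (neg _) (neg _)) (trans (sym (-1*x≈-x _)) (*-congˡ (*-cong (neg _) (neg _)))) ⟩
    (1# + ν * (x * (u * v))) * (1# + ν * (x * y * v))
      + ν * ((1# + ν * (x * v)) * (1# + ν * (x * y * (u * v))))
      ≈⟨ vanish _ ⟨
    (1# + ν * (x * (u * v))) * (1# + ν * (x * y * v))
      + ν * ((1# + ν * (x * v)) * (1# + ν * (x * y * (u * v)))) + (1# + ν) * (x * v)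
      ≈⟨ solve 5 (λ ν x y u v →
           (con 1 :+ ν :* (x :* (u :* v))) :* (con 1 :+ ν :* (x :* y :* v))
             :+ ν :* ((con 1 :+ ν :* (x :* v)) :* (con 1 :+ ν :* (x :* y :* (u :* v))))
             :+ (con 1 :+ ν) :* (x :* v)
           := (con 1 :+ ν :* u) :* (v :* (x :* (con 1 :+ ν :* y)))
             :+ (con 1 :+ ν) :* (con 1 :+ ν :* (x :* v) :+ ν :* ν :* (x :* (x :* y) :* u :* (v :* v))))
           refl ν x y u v ⟩
    (1# + ν * u) * (v * (x * (1# + ν * y)))
      + (1# + ν) * (1# + ν * (x * v) + ν * ν * (x * (x * y) * u * (v * v)))
      ≈⟨ vanish _ ⟩
    (1# + ν * u) * (v * (x * (1# + ν * y)))
      ≈⟨ *-cong (neg u) (*-congˡ (*-congˡ (neg y))) ⟨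
    (1# - u) * (v * (x * (1# - y))) ∎
    where
    ν = - 1#
    neg : ∀ z → 1# - z ≈ 1# + ν * z
    neg z = +-congˡ (sym (-1*x≈-x z))
    vanish : ∀ {z} t → z + (1# + ν) * t ≈ z
    vanish t = trans (+-congˡ (trans (*-congʳ (-‿inverseʳ 1#)) (zeroˡ t))) (+-identityʳ _)

-- The Hankel determinant over a field.

module HankelDeterminant {c ℓ} (F : DiscreteField c ℓ) where
  open DiscreteField F
  open RingNotation commutativeRing
  open Moments F using (μ)
  open Determinant commutativeRing
  open ShiftedFactorial commutativeRing
  open RingProperties ring using (-‿distribˡ-*; -‿distribʳ-*)
  open Exponentiation commutativeSemiring using (^-homo-*; ^-congʳ; ^-distrib-*)
  open NaturalCoefficients commutativeSemiring
  open SetoidReasoning setoid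

  ⁻¹-unique : ∀ {x y} → x * y ≈ 1# → x ⁻¹ ≈ y
  ⁻¹-unique {x} {y} xy≈1 = begin
    x ⁻¹              ≈⟨ *-identityʳ _ ⟨
    x ⁻¹ * 1#         ≈⟨ *-congˡ xy≈1 ⟨
    x ⁻¹ * (x * y)    ≈⟨ solve 3 (λ x y z → z :* (x :* y) := x :* z :* y) refl x y (x ⁻¹) ⟩
    x * x ⁻¹ * y      ≈⟨ *-congʳ (*-inverseʳ x λ x≈0 → 1≉0 (trans (sym xy≈1) (trans (*-congʳ x≈0) (zeroˡ y)))) ⟩
    1# * y            ≈⟨ *-identityˡ y ⟩
    y                 ∎

  ⁻¹-cong : ∀ {x y} → x ≈ y → x ⁻¹ ≈ y ⁻¹
  ⁻¹-cong {x} {y} x≈y with y ≟ 0#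
  ... | yes y≈0 = trans (0⁻¹≈0 x (trans x≈y y≈0)) (sym (0⁻¹≈0 y y≈0))
  ... | no  y≉0 = ⁻¹-unique (trans (*-congʳ x≈y) (*-inverseʳ y y≉0))

  -- If a factor is zero, both sides vanish because inversion sends zero to zero; otherwise
  -- `⁻¹-unique` applies.
  ⁻¹-distrib-* : ∀ x y → (x * y) ⁻¹ ≈ x ⁻¹ * y ⁻¹
  ⁻¹-distrib-* x y with x ≟ 0# | y ≟ 0#
  ... | yes x≈0 | _       = trans (0⁻¹≈0 _ (trans (*-congʳ x≈0) (zeroˡ y)))
                              (sym (trans (*-congʳ (0⁻¹≈0 x x≈0)) (zeroˡ _)))
  ... | no  _   | yes y≈0 = trans (0⁻¹≈0 _ (trans (*-congˡ y≈0) (zeroʳ x)))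
                              (sym (trans (*-congˡ (0⁻¹≈0 y y≈0)) (zeroʳ _)))
  ... | no  x≉0 | no  y≉0 = ⁻¹-unique (begin
    x * y * (x ⁻¹ * y ⁻¹)    ≈⟨ solve 4 (λ x y u v → x :* y :* (u :* v) := x :* u :* (y :* v)) refl x y (x ⁻¹) (y ⁻¹) ⟩
    x * x ⁻¹ * (y * y ⁻¹)    ≈⟨ *-cong (*-inverseʳ x x≉0) (*-inverseʳ y y≉0) ⟩
    1# * 1#                  ≈⟨ *-identityˡ 1# ⟩
    1#                       ∎)

  /-difference : ∀ {x y z w} → ¬ w ≈ 0# → ¬ y ≈ 0# →
    z / w - x / y ≈ (z * y - x * w) * (w ⁻¹ * y ⁻¹)
  /-difference {x} {y} {z} {w} w≉0 y≉0 = begin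
    z * w ⁻¹ - x * y ⁻¹
      ≈⟨ +-cong (expand z y≉0) (-‿cong (trans (expand x w≉0) (*-congˡ (*-comm _ _)))) ⟩
    z * y * (w ⁻¹ * y ⁻¹) - x * w * (w ⁻¹ * y ⁻¹)
      ≈⟨ +-congˡ (-‿distribˡ-* _ _) ⟩
    z * y * (w ⁻¹ * y ⁻¹) + (- (x * w)) * (w ⁻¹ * y ⁻¹)
      ≈⟨ distribʳ _ _ _ ⟨
    (z * y - x * w) * (w ⁻¹ * y ⁻¹) ∎
    where
    expand : ∀ u {v t} → ¬ t ≈ 0# → u * v ≈ u * t * (v * t ⁻¹)
    expand u {v} {t} t≉0 = begin
      u * v                  ≈⟨ *-identityʳ _ ⟨
      u * v * 1#             ≈⟨ *-congˡ (*-inverseʳ t t≉0) ⟨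
      u * v * (t * t ⁻¹)     ≈⟨ solve 4 (λ u v t s → u :* v :* (t :* s) := u :* t :* (v :* s)) refl u v t (t ⁻¹) ⟩
      u * t * (v * t ⁻¹)     ∎

  1/1≈1 : 1# / 1# ≈ 1#
  1/1≈1 = *-inverseʳ 1# 1≉0

  module _ (a b q : Carrier) where
    C : Carrier
    C = a * b * q ^ 2

    -- The row and column factors of the minor left by the elimination. The last factor of `σ`
    -- depends on neither index: it is the constant in `μ-shift`, assigned to the columns by choice.
    ρ σ : ℕ → Carrier
    ρ i = 1# - q ^ suc i
    σ j = q ^ j * (a * q * (1# - b * q)) * (1# - C * q ^ j) ⁻¹
        * ((1# - a * q) * ((1# - C) * (1# - C * q)) ⁻¹)

    -- `quotient m` is the factor of the claimed product at `n - k = m`. With its share of the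
    -- powers of `a` and `q` it becomes `pivot m`, the factor by which the determinant grows from
    -- order `m` to order `m + 1`.
    quotient pivot : ℕ → Carrier
    quotient m = (⟨ q ⨾ q ⟩ m * ⟨ a * q ⨾ q ⟩ m * ⟨ b * q ⨾ q ⟩ m)
           / (⟨ a * b * q ^ (m ℕ.+ 1) ⨾ q ⟩ m * ⟨ a * b * q ^ 2 ⨾ q ⟩ (2 ℕ.* m))
    pivot m = a ^ m * q ^ (m ℕ.* m) * quotient m

    C-shift : C * q * q ≈ a * q * (b * q) * q ^ 2
    C-shift = solve 3 (λ a b q → a :* b :* (q :* (q :* con 1)) :* q :* q
                              := a :* q :* (b :* q) :* (q :* (q :* con 1))) refl a b q

    -- The form `x * y`, with `x = a * q` and `y = b * q`, in which `cross-difference` is applied.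
    C-factor : C ≈ a * q * (b * q)
    C-factor = solve 3 (λ a b q → a :* b :* (q :* (q :* con 1)) := a :* q :* (b :* q)) refl a b q

    ⟨C⟩-cons₂ : ∀ m → ⟨ C ⨾ q ⟩ (suc (suc m)) ≈
                      (1# - C) * (1# - C * q) * ⟨ a * q * (b * q) * q ^ 2 ⨾ q ⟩ m
    ⟨C⟩-cons₂ m = begin
      ⟨ C ⨾ q ⟩ (suc (suc m))                          ≈⟨ ⟨⟩-cons C q (suc m) ⟩
      (1# - C) * ⟨ C * q ⨾ q ⟩ (suc m)                 ≈⟨ *-congˡ (⟨⟩-cons (C * q) q m) ⟩
      (1# - C) * ((1# - C * q) * ⟨ C * q * q ⨾ q ⟩ m)  ≈⟨ *-assoc _ _ _ ⟨
      (1# - C) * (1# - C * q) * ⟨ C * q * q ⨾ q ⟩ m    ≈⟨ *-congˡ (⟨⟩-cong q m C-shift) ⟩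
      (1# - C) * (1# - C * q) * ⟨ a * q * (b * q) * q ^ 2 ⨾ q ⟩ m ∎

    μ-suc : ∀ m → μ a b q (suc m) ≈ μ a b q m * ((1# - a * q * q ^ m) / (1# - C * q ^ m))
    μ-suc m = begin
      ⟨ a * q ⨾ q ⟩ (suc m) * (⟨ C ⨾ q ⟩ (suc m)) ⁻¹
        ≈⟨ *-cong (⟨⟩-snoc (a * q) q m) (trans (⁻¹-cong (⟨⟩-snoc C q m)) (⁻¹-distrib-* _ _)) ⟩
      ⟨ a * q ⨾ q ⟩ m * (1# - a * q * q ^ m) * ((⟨ C ⨾ q ⟩ m) ⁻¹ * (1# - C * q ^ m) ⁻¹)
        ≈⟨ solve 4 (λ x y z w → x :* y :* (z :* w) := x :* z :* (y :* w)) refl _ _ _ _ ⟩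
      μ a b q m * ((1# - a * q * q ^ m) / (1# - C * q ^ m)) ∎

    -- The extra divisor completes the denominator to length `m + 2`. Its first two factors and the
    -- first factor of the numerator split off, and the rest is the moment for `a * q` and `b * q`.
    μ-shift : ∀ m → μ a b q (suc m) / (1# - C * q ^ suc m) ≈
                    (1# - a * q) / ((1# - C) * (1# - C * q)) * μ (a * q) (b * q) q m
    μ-shift m = begin
      ⟨ a * q ⨾ q ⟩ (suc m) * (⟨ C ⨾ q ⟩ (suc m)) ⁻¹ * (1# - C * q ^ suc m) ⁻¹
        ≈⟨ trans (*-assoc _ _ _) (*-congˡ (sym (⁻¹-distrib-* _ _))) ⟩
      ⟨ a * q ⨾ q ⟩ (suc m) * (⟨ C ⨾ q ⟩ (suc m) * (1# - C * q ^ suc m)) ⁻¹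
        ≈⟨ *-cong (⟨⟩-cons (a * q) q m) (trans (⁻¹-cong (trans (sym (⟨⟩-snoc C q (suc m))) (⟨C⟩-cons₂ m)))
                                               (⁻¹-distrib-* _ _)) ⟩
      (1# - a * q) * ⟨ a * q * q ⨾ q ⟩ m
        * (((1# - C) * (1# - C * q)) ⁻¹ * (⟨ a * q * (b * q) * q ^ 2 ⨾ q ⟩ m) ⁻¹)
        ≈⟨ solve 4 (λ x y z w → x :* y :* (z :* w) := x :* z :* (y :* w)) refl _ _ _ _ ⟩
      (1# - a * q) / ((1# - C) * (1# - C * q)) * μ (a * q) (b * q) q m ∎

    pivot-zero : pivot 0 ≈ 1#
    pivot-zero = trans (*-cong (*-identityˡ 1#) (trans
      (*-cong (trans (*-congʳ (*-identityˡ 1#)) (*-identityˡ 1#)) (⁻¹-cong (*-identityˡ 1#))) 1/1≈1))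
      (*-identityˡ 1#)

    -- Both terms are multiples of `μ a b q (suc m)` with `m = i + j`. By `cross-difference` at
    -- `u = q ^ suc i` and `v = q ^ j`, the numerator of the difference of the multipliers separates
    -- into a row part and a column part. The one denominator that mixes `i` and `j` is absorbed by
    -- `μ-shift`.
    eliminate : (∀ i → ¬ 1# - C * q ^ i ≈ 0#) → ∀ i j →
      μ a b q (suc (suc (i ℕ.+ j))) - (1# - a * q * q ^ j) / (1# - C * q ^ j) * μ a b q (suc (i ℕ.+ j))
        ≈ ρ i * σ j * μ (a * q) (b * q) q (i ℕ.+ j)
    eliminate C≉ i j = begin
      μ a b q (suc (suc m)) - x / y * μ a b q (suc m)
        ≈⟨ +-cong (μ-suc (suc m)) (-‿cong (*-comm _ _)) ⟩
      μ a b q (suc m) * (z / w) - μ a b q (suc m) * (x / y)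
        ≈⟨ trans (+-congˡ (-‿distribʳ-* _ _)) (sym (distribˡ _ _ _)) ⟩
      μ a b q (suc m) * (z / w - x / y)
        ≈⟨ *-congˡ (/-difference (C≉ (suc m)) (C≉ j)) ⟩
      μ a b q (suc m) * ((z * y - x * w) * (w ⁻¹ * y ⁻¹))
        ≈⟨ *-congˡ (*-congʳ numerator) ⟩
      μ a b q (suc m) * (ρ i * (q ^ j * (a * q * (1# - b * q))) * (w ⁻¹ * y ⁻¹))
        ≈⟨ solve 5 (λ p r s w y → p :* (r :* s :* (w :* y)) := r :* (s :* y) :* (p :* w)) refl _ _ _ _ _ ⟩
      ρ i * (q ^ j * (a * q * (1# - b * q)) * y ⁻¹) * (μ a b q (suc m) * w ⁻¹)
        ≈⟨ *-congˡ (μ-shift m) ⟩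
      ρ i * (q ^ j * (a * q * (1# - b * q)) * y ⁻¹)
        * ((1# - a * q) / ((1# - C) * (1# - C * q)) * μ (a * q) (b * q) q m)
        ≈⟨ solve 4 (λ r s t p → r :* s :* (t :* p) := r :* (s :* t) :* p) refl _ _ _ _ ⟩
      ρ i * σ j * μ (a * q) (b * q) q m ∎
      where
      m = i ℕ.+ j
      x = 1# - a * q * q ^ j
      y = 1# - C * q ^ j
      z = 1# - a * q * q ^ suc m
      w = 1# - C * q ^ suc m
      numerator : z * y - x * w ≈ ρ i * (q ^ j * (a * q * (1# - b * q)))
      numerator = trans
        (+-cong (*-cong (1-‿cong (*-congˡ (^-homo-* q (suc i) j))) (1-‿cong (*-congʳ C-factor)))
          (-‿cong (*-congˡ (1-‿cong (*-cong C-factor (^-homo-* q (suc i) j))))))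
        (cross-difference (a * q) (b * q) (q ^ suc i) (q ^ j))

  -- The exponents of q satisfy (m+1)² = m² + 2m + 1; one m comes from (aq)^m.
  pivot-suc : ∀ a b q m → pivot a b q (suc m) ≈ ρ a b q m * σ a b q m * pivot (a * q) (b * q) q m
  pivot-suc a b q m = begin
    a * a ^ m * q ^ (suc m ℕ.* suc m) * (Nₛ * Dₛ ⁻¹)
      ≈⟨ *-cong (*-congˡ power) (*-cong numerator (trans (⁻¹-cong denominator) inverse)) ⟩
    a * a ^ m * (q * (q ^ m * (q ^ m * q ^ (m ℕ.* m))))
      * (Q * (1# - q * q ^ m) * ((1# - a * q) * A) * ((1# - b * q) * B)
         * ((1# - K * q ^ m) ⁻¹ * s ⁻¹ * (X * Y) ⁻¹))
      -- One `q ^ m` goes into `σ`, the other stays with `a ^ m`; the single `q` joins `a` in the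
      -- factor `a * q` of `σ`.
      ≈⟨ solve 14 (λ a aᵐ q qᵐ qᵐᵐ Q r α A β B u s w →
           a :* aᵐ :* (q :* (qᵐ :* (qᵐ :* qᵐᵐ))) :* (Q :* r :* (α :* A) :* (β :* B) :* (u :* s :* w))
           := r :* (qᵐ :* (a :* q :* β) :* u :* (α :* s)) :* (aᵐ :* qᵐ :* qᵐᵐ :* (Q :* A :* B :* w)))
           refl a (a ^ m) q (q ^ m) (q ^ (m ℕ.* m)) Q (1# - q * q ^ m) (1# - a * q) A (1# - b * q) B
           ((1# - K * q ^ m) ⁻¹) (s ⁻¹) ((X * Y) ⁻¹) ⟩
    ρ a b q m * σ a b q m * (a ^ m * q ^ m * q ^ (m ℕ.* m) * (Q * A * B * (X * Y) ⁻¹))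
      ≈⟨ *-congˡ (*-congʳ (*-congʳ (^-distrib-* a q m))) ⟨
    ρ a b q m * σ a b q m * pivot (a * q) (b * q) q m ∎
    where
    K = C a b q
    s = (1# - K) * (1# - K * q)
    Q = ⟨ q ⨾ q ⟩ m
    A = ⟨ a * q * q ⨾ q ⟩ m
    B = ⟨ b * q * q ⨾ q ⟩ m
    X = ⟨ a * q * (b * q) * q ^ (m ℕ.+ 1) ⨾ q ⟩ m
    Y = ⟨ a * q * (b * q) * q ^ 2 ⨾ q ⟩ (2 ℕ.* m)
    Nₛ = ⟨ q ⨾ q ⟩ (suc m) * ⟨ a * q ⨾ q ⟩ (suc m) * ⟨ b * q ⨾ q ⟩ (suc m)
    Dₛ = ⟨ a * b * q ^ (suc m ℕ.+ 1) ⨾ q ⟩ (suc m) * ⟨ K ⨾ q ⟩ (2 ℕ.* suc m)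

    power : q ^ (suc m ℕ.* suc m) ≈ q * (q ^ m * (q ^ m * q ^ (m ℕ.* m)))
    power = *-congˡ (trans (^-homo-* q m (m ℕ.* suc m)) (*-congˡ
      (trans (^-congʳ q (ℕ.*-suc m m)) (^-homo-* q m (m ℕ.* m)))))

    numerator : Nₛ ≈ Q * (1# - q * q ^ m) * ((1# - a * q) * A) * ((1# - b * q) * B)
    numerator = *-cong (*-cong (⟨⟩-snoc q q m) (⟨⟩-cons (a * q) q m)) (⟨⟩-cons (b * q) q m)

    -- The first product starts with `1 - abq^(m+2)`, which is `1 - K q^m`, and continues from base
    -- `abq^(m+3)`, the base of `X`. The second, of length `2m + 2`, loses its first two factors to
    -- `s`.
    denominator : Dₛ ≈ (1# - K * q ^ m) * X * (s * Y)
    denominator = *-cong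
      (trans (⟨⟩-cons _ q m) (*-cong
        (1-‿cong (trans (*-congˡ (*-congˡ (^-congʳ q (ℕ.+-comm m 1))))
          (solve 4 (λ a b q p → a :* b :* (q :* (q :* p)) := a :* b :* (q :* (q :* con 1)) :* p)
             refl a b q (q ^ m))))
        (⟨⟩-cong q m (solve 4 (λ a b q p → a :* b :* (q :* p) :* q := a :* q :* (b :* q) :* p)
             refl a b q (q ^ (m ℕ.+ 1))))))
      (trans (reflexive (≡.cong (λ l → ⟨ K ⨾ q ⟩ (suc l)) (ℕ.+-suc m (m ℕ.+ 0))))
             (⟨C⟩-cons₂ a b q (2 ℕ.* m)))

    inverse : ((1# - K * q ^ m) * X * (s * Y)) ⁻¹ ≈ (1# - K * q ^ m) ⁻¹ * s ⁻¹ * (X * Y) ⁻¹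
    inverse = begin
      ((1# - K * q ^ m) * X * (s * Y)) ⁻¹
        ≈⟨ ⁻¹-cong (solve 4 (λ u x s y → u :* x :* (s :* y) := u :* s :* (x :* y)) refl _ _ _ _) ⟩
      ((1# - K * q ^ m) * s * (X * Y)) ⁻¹
        ≈⟨ trans (⁻¹-distrib-* _ _) (*-congʳ (⁻¹-distrib-* _ _)) ⟩
      (1# - K * q ^ m) ⁻¹ * s ⁻¹ * (X * Y) ⁻¹ ∎

  -- The induction replaces `a` and `b` by `a * q` and `b * q`, so it runs over arbitrary field
  -- elements, with nonvanishing factors in place of indeterminacy.
  hankel : ∀ n a b q → (∀ i → ¬ 1# - C a b q * q ^ i ≈ 0#) →
    det (λ (i j : Fin n) → μ a b q (toℕ i ℕ.+ toℕ j)) ≈ product {n} (λ i → pivot a b q (toℕ i))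
  hankel zero    a b q C≉ = refl
  hankel (suc n) a b q C≉ = begin
    det M
      ≈⟨ det-addColumns x M M′ (λ i → refl) (λ i j → refl) ⟨
    det M′
      ≈⟨ det-firstRow M′ 1/1≈1 top ⟩
    det (minor M′ zero)
      ≈⟨ det-cong entries ⟩
    det (λ i j → ρ a b q (toℕ i) * σ a b q (toℕ j) * N i j)
      ≈⟨ det-scale {n} (λ i → ρ a b q (toℕ i)) (λ j → σ a b q (toℕ j)) N ⟩
    product {n} (λ i → ρ a b q (toℕ i)) * product {n} (λ i → σ a b q (toℕ i)) * det N
      ≈⟨ *-cong (product-distrib-* {n} (λ i → ρ a b q (toℕ i)) (λ i → σ a b q (toℕ i)))
                (sym (hankel n (a * q) (b * q) q C≉′)) ⟨
    product {n} (λ i → ρ a b q (toℕ i) * σ a b q (toℕ i))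
      * product {n} (λ i → pivot (a * q) (b * q) q (toℕ i))
      ≈⟨ product-distrib-* {n} (λ i → ρ a b q (toℕ i) * σ a b q (toℕ i))
                               (λ i → pivot (a * q) (b * q) q (toℕ i)) ⟨
    product {n} (λ i → ρ a b q (toℕ i) * σ a b q (toℕ i) * pivot (a * q) (b * q) q (toℕ i))
      ≈⟨ product-cong {n} (λ i → pivot-suc a b q (toℕ i)) ⟨
    product {n} (λ i → pivot a b q (suc (toℕ i)))
      ≈⟨ *-identityˡ _ ⟨
    1# * product {n} (λ i → pivot a b q (suc (toℕ i)))
      ≈⟨ *-congʳ (pivot-zero a b q) ⟨
    product {suc n} (λ i → pivot a b q (toℕ i)) ∎
    where
    -- By `μ-suc` this is the multiplier from moment `j` to moment `j + 1`, so its use clears the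
    -- first row.
    κ : ℕ → Carrier
    κ j = (1# - a * q * q ^ j) / (1# - C a b q * q ^ j)
    x : Fin n → Carrier
    x j = - κ (toℕ j)
    M M′ : Matrix (suc n)
    M i j = μ a b q (toℕ i ℕ.+ toℕ j)
    M′ i zero    = M i zero
    M′ i (suc j) = M i (suc j) + x j * M i (inject₁ j)
    N : Matrix n
    N i j = μ (a * q) (b * q) q (toℕ i ℕ.+ toℕ j)

    column : ∀ i j → M′ i (suc j) ≈
      μ a b q (toℕ i ℕ.+ suc (toℕ j)) - κ (toℕ j) * μ a b q (toℕ i ℕ.+ toℕ j)
    column i j = +-congˡ (trans
      (*-congˡ (reflexive (≡.cong (λ l → μ a b q (toℕ i ℕ.+ l)) (Fin.toℕ-inject₁ j))))
      (sym (-‿distribˡ-* _ _)))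

    top : ∀ j → M′ zero (suc j) ≈ 0#
    top j = trans (column zero j)
      (trans (+-congʳ (trans (μ-suc a b q (toℕ j)) (*-comm _ _))) (-‿inverseʳ _))

    entries : ∀ i j → minor M′ zero i j ≈ ρ a b q (toℕ i) * σ a b q (toℕ j) * N i j
    entries i j = trans (column (suc i) j)
      (trans (+-congʳ (reflexive (≡.cong (λ l → μ a b q (suc l)) (ℕ.+-suc (toℕ i) (toℕ j)))))
             (eliminate a b q C≉ (toℕ i) (toℕ j)))

    -- The new parameters multiply `C` by the square of `q`, so the hypothesis is used two places
    -- further on.
    C≉′ : ∀ i → ¬ 1# - C (a * q) (b * q) q * q ^ i ≈ 0#
    C≉′ i e = C≉ (suc (suc i)) (trans (1-‿cong (trans
      (solve 3 (λ c q p → c :* (q :* (q :* p)) := c :* q :* q :* p) refl (C a b q) q (q ^ i))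
      (*-congʳ (C-shift a b q)))) e)

  -- The pivots run upward while `n ∸ k` runs downward, so the last pivot supplies the first factor
  -- of the new product.
  collect-powers : ∀ n a b q → product {n} (λ i → pivot a b q (toℕ i)) ≈
    a ^ triangular n * q ^ pyramidal n * (∏[ k ≤ n ] quotient a b q (n ∸ k))
  collect-powers zero    a b q = sym (trans (*-identityʳ _) (*-identityʳ _))
  collect-powers (suc n) a b q = begin
    product {suc n} (λ i → pivot a b q (toℕ i))
      ≈⟨ product-snoc n (pivot a b q) ⟩
    product {n} (λ i → pivot a b q (toℕ i)) * pivot a b q n
      ≈⟨ *-congʳ (collect-powers n a b q) ⟩
    a ^ triangular n * q ^ pyramidal n * P * (a ^ n * q ^ (n ℕ.* n) * quotient a b q n)
      ≈⟨ solve 6 (λ x y p u v g → x :* y :* p :* (u :* v :* g) := u :* x :* (v :* y) :* (g :* p))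
           refl _ _ _ _ _ _ ⟩
    a ^ n * a ^ triangular n * (q ^ (n ℕ.* n) * q ^ pyramidal n) * (quotient a b q n * P)
      ≈⟨ *-congʳ (*-cong (^-homo-* a n (triangular n)) (^-homo-* q (n ℕ.* n) (pyramidal n))) ⟨
    a ^ triangular (suc n) * q ^ pyramidal (suc n) * (∏[ k ≤ suc n ] quotient a b q (suc n ∸ k)) ∎
    where
    P = ∏[ k ≤ n ] quotient a b q (n ∸ k)

  hankel-formula : ∀ n a b q → (∀ m → ¬ ⟨ a * b * q ^ 2 ⨾ q ⟩ m ≈ 0#) →
    det (λ (i j : Fin n) → μ a b q (toℕ i ℕ.+ toℕ j)) ≈
      a ^ (n ℕ.* (n ∸ 1) ℕ./ 2) * q ^ (n ℕ.* (n ∸ 1) ℕ.* (2 ℕ.* n ∸ 1) ℕ./ 6)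
        * (∏[ k ≤ n ] quotient a b q (n ∸ k))
  hankel-formula n a b q ⟨C⟩≉0 = trans
    (trans (hankel n a b q C≉) (collect-powers n a b q))
    (*-congʳ (*-cong (^-congʳ a (≡.sym (triangular-closed n)))
                     (^-congʳ q (≡.sym (pyramidal-closed n)))))
    where
    -- Each such factor is the last one of a shifted factorial of length `suc i`, which would vanish
    -- with it.
    C≉ : ∀ i → ¬ 1# - C a b q * q ^ i ≈ 0#
    C≉ i e = ⟨C⟩≉0 (suc i) (trans (⟨⟩-snoc (C a b q) q i) (trans (*-congˡ e) (zeroʳ _)))

theorem1p1 : ∀ {c ℓ} (D : DiscreteDomain c ℓ) (n : ℕ) .{{_ : NonZero n}} →
    let open RationalFunctions D in
    det (λ (i j : Fin n) → μ (toℕ i ℕ.+ toℕ j))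
      ≈ a ^ ((n ℕ.* (n ∸ 1)) ℕ./ 2)
      * q ^ ((n ℕ.* (n ∸ 1) ℕ.* (2 ℕ.* n ∸ 1)) ℕ./ 6)
      * (∏[ k ≤ n ]
           ((⟨ q ⨾ q ⟩ (n ∸ k) * ⟨ a * q ⨾ q ⟩ (n ∸ k) * ⟨ b * q ⨾ q ⟩ (n ∸ k))
            / (⟨ a * b * q ^ (n ∸ k ℕ.+ 1) ⨾ q ⟩ (n ∸ k)
               * ⟨ a * b * q ^ 2 ⨾ q ⟩ (2 ℕ.* (n ∸ k)))))
-- `denominator≉0 i` concerns the base `a * b * q ^ suc i`; the moments have `i = 1`.
theorem1p1 D n = hankel-formula n a b q (denominator≉0 1)
  where
  open RationalFunctions D
  open HankelDeterminant rationalFunctions
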